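{- Let $G$ be a simple graph with $m$ edges and girth $g(G)\ge 5$. For an edge $uv$ write $G_{uv}=G-\{u,v\}$. Then the number $p(G;5)$ of $5$-matchings of $G$ equals $\frac15$ times \begin{align*} &\frac{1}{24}m(m^4+10m^3+43m^2+54m-328)+\frac54 M_1(G)^2-\frac12\alpha(G)(m-7)-\frac56\alpha_2(G)\\ &-\frac1{12}M_1(G)(2m^3+30m^2+61m-225)+\frac12\beta(G)+\frac1{12}M_2(G)(6m^2+66m-239)\\ &+\frac1{24}F(G)(6m^2+24m-149)+\frac1{12}M_1^4(G)(m+10)+\frac14 M_2^2(G)-EM_2(G)-\frac5{24}M_1^5(G)\\ &+\frac18\sum_{uv\in E(G)}M_1(G_{uv})^2+\frac13\sum_{uv\in E(G)}m(G_{uv})F(G_{uv})-\frac14\sum_{uv\in E(G)}m(G_{uv})^2M_1(G_{uv})\\ &-\sum_{uv\in E(G)}EM_2(G_{uv})+\sum_{uv\in E(G)}m(G_{uv})M_2(G_{uv}), \end{align*} where $M_1(\cdot)^2$ and $m(\cdot)^2$ denote squares of numbers.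
   Context: All graphs are finite, simple and undirected. A $k$-matching is a set of $k$ pairwise vertex-disjoint edges; $p(G;k)$ is the number of $k$-matchings. $m(H)$ is the number of edges of $H$; $G-\{u,v\}$ is obtained by deleting vertices $u,v$. $d_G(v)$ is the degree of $v$; the girth is the length of a shortest cycle. $M_1^\alpha(G)=\sum_v d_G(v)^\alpha$ (exponent on degrees), $M_1=M_1^2$, $F=M_1^3$; $M_2(G)=\sum_{uv\in E(G)}d_G(u)d_G(v)$; $M_2^2(G)=\sum_{uv\in E(G)}d_G(u)^2d_G(v)^2$; $\alpha_\lambda(G)=\sum_{uv\in E(G)}d_G(u)d_G(v)[d_G(u)^\lambda+d_G(v)^\lambda]$, $\alpha=\alpha_1$. For an edge $e=uv$, $d_G(e)=d_G(u)+d_G(v)-2$; $e\sim f$ means distinct edges sharing a vertex, $e\cap f$ is that vertex, and sums over $e\sim f$ are over unordered pairs; $EM_2(G)=\sum_{e\sim f}d_G(e)d_G(f)$; $\beta(G)=\sum_{e\sim f}d_G(e\cap f)(d_G(e)+d_G(f))$. -}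

module Defs where

open import Data.Fin using (Fin; toℕ; _<?_; _≟_)
open import Data.Fin.Subset using (Subset; _∈_; _-_)
open import Data.Fin.Subset.Properties using (_∈?_)
open import Data.Integer using (+_)
open import Data.List using (List; []; _∷_; _++_; map; filter; length; allFin; cartesianProduct)
open import Data.List.Relation.Unary.AllPairs using (allPairs?)
open import Data.Bool using (if_then_else_)
open import Data.Nat.ListAction using (sum)
open import Data.Nat using (ℕ; zero; suc; _+_; _*_; _∸_; _^_; _≤_)
open import Data.Product using (_×_; _,_)
open import Data.Rational as ℚ using (ℚ)
open import Data.Sum using (_⊎_)
open import Function.Definitions using (Injective)
open import Relation.Binary using (Rel; Decidable; Symmetric)
open import Relation.Binary.PropositionalEquality using (_≡_)
open import Relation.Nullary using (¬_; does; _×-dec_; _⊎-dec_; ¬?)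
open import Relation.Nullary.Construct.Add.Supremum using (_⁺; [_]; ⊤⁺)
open import Level using (0ℓ)

-- The vertex set is a subset of Fin n rather than all of Fin n, so that
-- deleting vertices does not relabel the remaining ones.
record Graph (n : ℕ) : Set₁ where
  infix 4 _~_ _~?_
  field
    vertexSet : Subset n
    _~_       : Rel (Fin n) 0ℓ
    _~?_      : Decidable _~_
    ~-sym     : Symmetric _~_
    ~-irrefl  : ∀ {v} → ¬ (v ~ v)
    ~⇒∈       : ∀ {u v} → u ~ v → u ∈ vertexSet

Edge : ℕ → Set
Edge n = Fin n × Fin n

infix 4 _∈ₑ_

_∈ₑ_ : ∀ {n} → Fin n → Edge n → Set
w ∈ₑ (u , v) = w ≡ u ⊎ w ≡ v

_∈ₑ?_ : ∀ {n} → Decidable (_∈ₑ_ {n})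
w ∈ₑ? (u , v) = (w ≟ u) ⊎-dec (w ≟ v)

Meet : ∀ {n} → Rel (Edge n) 0ℓ
Meet (u , v) f = u ∈ₑ f ⊎ v ∈ₑ f

meet? : ∀ {n} → Decidable (Meet {n})
meet? (u , v) f = (u ∈ₑ? f) ⊎-dec (v ∈ₑ? f)

-- The common vertex of two distinct edges that meet; a junk value otherwise.
_∩ₑ_ : ∀ {n} → Edge n → Edge n → Fin n
(u , v) ∩ₑ f = if does (u ∈ₑ? f) then u else v

Disjoint : ∀ {n} → Rel (Edge n) 0ℓ
Disjoint e f = ¬ Meet e f

disjoint? : ∀ {n} → Decidable (Disjoint {n})
disjoint? e f = ¬? (meet? e f)

-- All k-element sublists, by position.
sublists : ∀ {A : Set} → ℕ → List A → List (List A)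
sublists zero    _        = [] ∷ []
sublists (suc k) []       = []
sublists (suc k) (x ∷ xs) = map (x ∷_) (sublists k xs) ++ sublists (suc k) xs

-- All unordered pairs of entries at distinct positions.
pairs : ∀ {A : Set} → List A → List (A × A)
pairs []       = []
pairs (x ∷ xs) = map (x ,_) xs ++ pairs xs

∑ : ∀ {A : Set} → List A → (A → ℕ) → ℕ
∑ xs f = sum (map f xs)

module _ {n : ℕ} (G : Graph n) where
  open Graph G

  vertices : List (Fin n)
  vertices = filter (_∈? vertexSet) (allFin n)

  deg : Fin n → ℕ
  deg v = length (filter (v ~?_) vertices)

  -- Each edge is listed once, with its smaller endpoint first.
  edges : List (Edge n)
  edges = filter (λ (u , v) → (u <? v) ×-dec (u ~? v)) (cartesianProduct vertices vertices)

  size : ℕ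
  size = length edges

  -- Only used on edges, whose endpoints have degree ≥ 1, so ∸ is subtraction.
  edgeDeg : Edge n → ℕ
  edgeDeg (u , v) = deg u + deg v ∸ 2

  meetingPairs : List (Edge n × Edge n)
  meetingPairs = filter (λ (e , f) → meet? e f) (pairs edges)

  matchings : ℕ → List (List (Edge n))
  matchings k = filter (allPairs? disjoint?) (sublists k edges)

  p : ℕ → ℕ
  p k = length (matchings k)

  record Cycle (ℓ : ℕ) : Set where
    field
      vertex      : Fin ℓ → Fin n
      3≤ℓ         : 3 ≤ ℓ
      injective   : Injective _≡_ _≡_ vertex
      consecutive : ∀ i j → toℕ j ≡ suc (toℕ i) → vertex i ~ vertex j
      closing     : ∀ i j → suc (toℕ i) ≡ ℓ → toℕ j ≡ 0 → vertex i ~ vertex j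

  -- The girth of an acyclic graph is infinite.
  IsGirth : ℕ ⁺ → Set
  IsGirth [ g ] = Cycle g × (∀ {ℓ} → Cycle ℓ → g ≤ ℓ)
  IsGirth ⊤⁺    = ∀ {ℓ} → ¬ Cycle ℓ

  -- The superscript a is an exponent on the degrees: M₁^ 2, M₁^ 3 are M₁, F.
  M₁^ : ℕ → ℕ
  M₁^ a = ∑ vertices λ v → deg v ^ a

  M₁ : ℕ
  M₁ = M₁^ 2

  F : ℕ
  F = M₁^ 3

  M₂^ : ℕ → ℕ
  M₂^ a = ∑ edges λ (u , v) → deg u ^ a * deg v ^ a

  M₂ : ℕ
  M₂ = ∑ edges λ (u , v) → deg u * deg v

  α : ℕ → ℕ
  α l = ∑ edges λ (u , v) → deg u * deg v * (deg u ^ l + deg v ^ l)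

  EM₂ : ℕ
  EM₂ = ∑ meetingPairs λ (e , f) → edgeDeg e * edgeDeg f

  β : ℕ
  β = ∑ meetingPairs λ (e , f) → deg (e ∩ₑ f) * (edgeDeg e + edgeDeg f)

infixl 6 _-[_,_]

_-[_,_] : ∀ {n} → Graph n → Fin n → Fin n → Graph n
G -[ u , v ] = record
  { vertexSet = V
  ; _~_       = λ x y → x ~ y × x ∈ V × y ∈ V
  ; _~?_      = λ x y → (x ~? y) ×-dec (x ∈? V) ×-dec (y ∈? V)
  ; ~-sym     = λ (xy , x∈ , y∈) → ~-sym xy , y∈ , x∈
  ; ~-irrefl  = λ (xx , _) → ~-irrefl xx
  ; ~⇒∈       = λ (_ , x∈ , _) → x∈
  }
  where
  open Graph G
  V = vertexSet - u - v

infix 8 ↑_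

↑_ : ℕ → ℚ
↑ k = + k ℚ./ 1

-- Every k-matching contains k edges, so k · p(G; k) is the sum of p(G_uv; k − 1) over the edges uv.
-- Starting from p(G; 1) = m this gives p(G; 2), p(G; 3), p(G; 4) and p(G; 5) in turn, provided the
-- invariants of G_uv that occur can be averaged over uv. Girth at least 5 makes this possible: no
-- vertex is adjacent to both u and v and no other edge joins a neighbour of u to one of v, so
-- deleting u and v lowers each surviving degree by 0 or 1 and never both ends of a surviving edge.
-- Hence M₁(G_uv), F(G_uv), M₂(G_uv), … are explicit in the degrees near uv, and their sums over uv
-- reduce to degree sums of G and to T = Σ_u (Σ_{w~u} d(w))², which is expressible by EM₂(G).
module Submission where

open import Defs
open import Data.Bool using (if_then_else_)
open import Data.Fin using (Fin; zero; suc)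
import Data.Fin as Fin
open import Data.Fin.Patterns using (0F; 1F; 2F; 3F)
import Data.Fin.Properties as Fin
open import Data.Fin.Subset using (Subset; ∣_∣; ⁅_⁆) renaming (_∈_ to _∈ₛ_; _-_ to _∖_)
open import Data.Fin.Subset.Properties using (_∈?_; x∈p∧x≢y⇒x∈p-y; p─q⊆p; x∈p⇒∣p-x∣<∣p∣; p─q─q≡p─q)
open import Data.List using (List; []; _∷_; _++_; map; filter; length; allFin; cartesianProduct)
open import Data.List.Membership.Propositional using (_∈_)
open import Data.List.Membership.Propositional.Properties using (∈-filter⁺; ∈-filter⁻; ∈-allFin)
open import Data.List.Properties using (filter-++; filter-accept; filter-reject; filter-none; map-tabulate)
open import Data.List.Relation.Unary.All using (All; []; _∷_)
import Data.List.Relation.Unary.All as All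
import Data.List.Relation.Unary.All.Properties as All
open import Data.List.Relation.Unary.AllPairs using (allPairs?; []; _∷_)
open import Data.List.Relation.Unary.Any using (here; there)
open import Data.List.Relation.Unary.Unique.Propositional using (Unique)
open import Data.List.Relation.Unary.Unique.Propositional.Properties using (filter⁺; cartesianProduct⁺; allFin⁺)
open import Data.Nat as ℕ using (ℕ; zero; suc)
import Data.Nat.Properties as ℕ
open import Data.Product using (_×_; _,_; proj₁; proj₂)
open import Data.Sum using (inj₁; inj₂; [_,_]′)
open import Data.Vec.Functional using () renaming ([] to []ᶠ; _∷_ to _∷ᶠ_)
open import Function using (_∘_)
open import Level using (0ℓ)
open import Relation.Binary using (Rel; Decidable; tri<; tri≈; tri>)
open import Relation.Binary.Construct.Add.Supremum.NonStrict ℕ._≤_ using (_≤⁺_; [_]; _≤⊤⁺)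
open import Relation.Binary.PropositionalEquality using (_≡_; refl; sym; trans; cong; cong₂; _≢_; module ≡-Reasoning)
open import Relation.Nullary using (¬_; Dec; does; yes; no; contradiction; ¬?; _×-dec_; _⊎-dec_)
open import Relation.Nullary.Construct.Add.Supremum using (_⁺; [_])
open import Relation.Unary using (Pred) renaming (Decidable to Decidable₁)

-- Subtractions and fractions shape the calculation. The formula for `k`-matchings is multiplied by
-- `k!` and proved in the integers, where each step ends in a ring identity; rationals appear only
-- in the last step. Adjacency and survival become 0/1 indicators and vertex sums run over all of
-- `Fin n`, so that `G` and `G -[ u , v ]` are compared summand by summand, and what the girth
-- excludes becomes the vanishing of products of indicators.
--
-- Of the terms in the formula for 4-matchings of `G -[ u , v ]`, the powers of the size, its
-- product with `M₁`, and `M₁`, `F`, `M₂`, `M₁^ 4` by themselves are averaged over the edges. The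
-- remaining five are carried along as sums, and these are the five sums in the theorem. `T` comes
-- in through `M₂` and through the product of size and `M₁`. `β`, in contrast, is itself a
-- combination of `α`, `M₁^ 4`, `F`, `M₂` and `M₁`: its coefficient only fixes one of several
-- equivalent ways to write the result.

module IntegerCounts where

  -- Integer sums over lists and indicators of decidable propositions.

  open import Data.Integer as ℤ using (ℤ; 0ℤ; 1ℤ; _+_; _-_; _*_; -_)
  open import Data.Integer.Properties as ℤ using (+-comm; +-identityˡ; +-identityʳ; *-comm; *-assoc; *-identityˡ; *-identityʳ; *-zeroˡ; *-zeroʳ)
  open import Data.Integer.Tactic.RingSolver using (ring; solve-∀)
  open import Tactic.RingSolver.Core.AlmostCommutativeRing using (AlmostCommutativeRing)

  -- The power that solve-∀ recognises.
  open AlmostCommutativeRing ring public using () renaming (_^_ to _^′_)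

  private variable
    A B : Set

  -- The solver's power multiplies on the right and treats exponent 1 as a base case, so the
  -- recursion of `ℕ._^_` has to be recovered for it.
  ^-suc : ∀ x k → x ^′ suc k ≡ x * x ^′ k
  ^-suc x zero          = sym (*-identityʳ x)
  ^-suc x (suc zero)    = refl
  ^-suc x (suc (suc k)) = trans (cong (_* x) (^-suc x (suc k))) (*-assoc x (x ^′ suc k) x)

  infix 8 ♯_

  -- Opaque, unlike the constants ℤ.+ k: otherwise a sum of two such terms would reduce to a single
  -- constructor application.
  opaque
    ♯_ : ℕ → ℤ
    ♯ k = ℤ.+ k

    ♯≡+ : ∀ k → ♯ k ≡ ℤ.+ k
    ♯≡+ k = refl

    ♯-homo-+ : ∀ j k → ♯ (j ℕ.+ k) ≡ ♯ j + ♯ k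
    ♯-homo-+ j k = refl

    ♯-homo-* : ∀ j k → ♯ (j ℕ.* k) ≡ ♯ j * ♯ k
    ♯-homo-* = ℤ.pos-*

  ♯-homo-^ : ∀ j k → ♯ (j ℕ.^ k) ≡ (♯ j) ^′ k
  ♯-homo-^ j zero    = ♯≡+ 1
  ♯-homo-^ j (suc k) = trans (♯-homo-* j (j ℕ.^ k)) (trans (cong (♯ j *_) (♯-homo-^ j k)) (sym (^-suc (♯ j) k)))

  ⟦_⟧ : {P : Set} → Dec P → ℤ
  ⟦ yes _ ⟧ = 1ℤ
  ⟦ no  _ ⟧ = 0ℤ

  ⟦⟧-cong : {P Q : Set} (p? : Dec P) (q? : Dec Q) → (P → Q) → (Q → P) → ⟦ p? ⟧ ≡ ⟦ q? ⟧
  ⟦⟧-cong (yes p) (yes q) f g = refl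
  ⟦⟧-cong (yes p) (no ¬q) f g = contradiction (f p) ¬q
  ⟦⟧-cong (no ¬p) (yes q) f g = contradiction (g q) ¬p
  ⟦⟧-cong (no ¬p) (no ¬q) f g = refl

  ⟦⟧-true : {P : Set} (p? : Dec P) → P → ⟦ p? ⟧ ≡ 1ℤ
  ⟦⟧-true (yes _) p = refl
  ⟦⟧-true (no ¬p) p = contradiction p ¬p

  ⟦⟧-false : {P : Set} (p? : Dec P) → ¬ P → ⟦ p? ⟧ ≡ 0ℤ
  ⟦⟧-false (yes p) ¬p = contradiction p ¬p
  ⟦⟧-false (no _)  ¬p = refl

  ⟦⟧-× : {P Q : Set} (p? : Dec P) (q? : Dec Q) → ⟦ p? ×-dec q? ⟧ ≡ ⟦ p? ⟧ * ⟦ q? ⟧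
  ⟦⟧-× (yes p) (yes q) = refl
  ⟦⟧-× (yes p) (no ¬q) = refl
  ⟦⟧-× (no ¬p) (yes q) = refl
  ⟦⟧-× (no ¬p) (no ¬q) = refl

  ⟦⟧-idem : {P : Set} (p? : Dec P) → ⟦ p? ⟧ * ⟦ p? ⟧ ≡ ⟦ p? ⟧
  ⟦⟧-idem (yes _) = refl
  ⟦⟧-idem (no _)  = refl

  infixl 6 _⊕_ _⊖_
  infixr 7 _⊛_

  -- Opaque, so that unification recovers f from Σ xs f.
  opaque
    Σ : List A → (A → ℤ) → ℤ
    Σ []       f = 0ℤ
    Σ (x ∷ xs) f = f x + Σ xs f

    Σ-cong-∈ : ∀ {f g : A → ℤ} (xs : List A) → (∀ {x} → x ∈ xs → f x ≡ g x) → Σ xs f ≡ Σ xs g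
    Σ-cong-∈ []       eq = refl
    Σ-cong-∈ (x ∷ xs) eq = cong₂ _+_ (eq (here refl)) (Σ-cong-∈ xs (eq ∘ there))

    Σ-[] : ∀ {f : A → ℤ} → Σ [] f ≡ 0ℤ
    Σ-[] = refl

    Σ-∷ : ∀ {x} {xs : List A} {f} → Σ (x ∷ xs) f ≡ f x + Σ xs f
    Σ-∷ = refl

    -- Stated for evaluated sums, so that known totals combine into one expression that mirrors the
    -- summand; at `refl` it is plain additivity.
    _⊕_ : ∀ {xs : List A} {f g s t} → Σ xs f ≡ s → Σ xs g ≡ t → Σ xs (λ x → f x + g x) ≡ s + t
    _⊕_ {xs = xs} {f} {g} refl refl = go xs
      where
      interchange : ∀ a b c d → (a + b) + (c + d) ≡ (a + c) + (b + d)
      interchange = solve-∀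
      go : ∀ xs → Σ xs (λ x → f x + g x) ≡ Σ xs f + Σ xs g
      go []       = refl
      go (x ∷ xs) = trans (cong ((f x + g x) +_) (go xs)) (interchange (f x) (g x) (Σ xs f) (Σ xs g))

    _⊛_ : ∀ {xs : List A} {f s} c → Σ xs f ≡ s → Σ xs (λ x → c * f x) ≡ c * s
    _⊛_ {xs = xs} {f} c refl = go xs
      where
      distrib : ∀ c a b → c * a + c * b ≡ c * (a + b)
      distrib = solve-∀
      go : ∀ xs → Σ xs (λ x → c * f x) ≡ c * Σ xs f
      go []       = sym (*-zeroʳ c)
      go (x ∷ xs) = trans (cong (c * f x +_) (go xs)) (distrib c (f x) (Σ xs f))

    Σ-zero : ∀ (xs : List A) → Σ xs (λ _ → 0ℤ) ≡ 0ℤ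
    Σ-zero []       = refl
    Σ-zero (_ ∷ xs) = trans (+-identityˡ _) (Σ-zero xs)

    Σ-++ : ∀ (xs ys : List A) {f} → Σ (xs ++ ys) f ≡ Σ xs f + Σ ys f
    Σ-++ []       ys     = sym (+-identityˡ _)
    Σ-++ (x ∷ xs) ys {f} = trans (cong (f x +_) (Σ-++ xs ys)) (+-assoc (f x) (Σ xs f) (Σ ys f))
      where
      +-assoc : ∀ a b c → a + (b + c) ≡ a + b + c
      +-assoc = solve-∀

    Σ-map : ∀ (g : A → B) (xs : List A) {f} → Σ (map g xs) f ≡ Σ xs (f ∘ g)
    Σ-map g []           = refl
    Σ-map g (x ∷ xs) {f} = cong (f (g x) +_) (Σ-map g xs)

    Σ-cartesianProduct : ∀ (xs : List A) (ys : List B) {f} →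
                         Σ (cartesianProduct xs ys) f ≡ Σ xs λ x → Σ ys λ y → f (x , y)
    Σ-cartesianProduct []       ys = refl
    Σ-cartesianProduct (x ∷ xs) ys =
      trans (Σ-++ (map (x ,_) ys) _) (cong₂ _+_ (Σ-map (x ,_) ys) (Σ-cartesianProduct xs ys))

    Σ-filter : ∀ {P : Pred A 0ℓ} (P? : Decidable₁ P) (xs : List A) {f} →
               Σ (filter P? xs) f ≡ Σ xs λ x → ⟦ P? x ⟧ * f x
    Σ-filter P? []       = refl
    Σ-filter P? (x ∷ xs) {f} with P? x
    ... | yes _ = cong₂ _+_ (sym (*-identityˡ (f x))) (Σ-filter P? xs)
    ... | no  _ = trans (Σ-filter P? xs) (sym (trans (cong (_+ Σ xs (λ y → ⟦ P? y ⟧ * f y)) (*-zeroˡ (f x))) (+-identityˡ _)))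

    ♯-length : ∀ (xs : List A) → ♯ length xs ≡ Σ xs (λ _ → 1ℤ)
    ♯-length []       = ♯≡+ 0
    ♯-length (_ ∷ xs) = trans (♯-homo-+ 1 (length xs)) (cong₂ _+_ (♯≡+ 1) (♯-length xs))

    ♯-∑ : ∀ (xs : List A) f → ♯ (∑ xs f) ≡ Σ xs (λ x → ♯ f x)
    ♯-∑ []       f = ♯≡+ 0
    ♯-∑ (x ∷ xs) f = trans (♯-homo-+ (f x) _) (cong (♯ f x +_) (♯-∑ xs f))

  Σ-cong : ∀ {f g : A → ℤ} (xs : List A) → (∀ x → f x ≡ g x) → Σ xs f ≡ Σ xs g
  Σ-cong xs eq = Σ-cong-∈ xs λ {x} _ → eq x

  _⊖_ : ∀ {xs : List A} {f g s t} → Σ xs f ≡ s → Σ xs g ≡ t → Σ xs (λ x → f x - g x) ≡ s - t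
  _⊖_ {xs = xs} {f} {g} {s} {t} p q = begin
    Σ xs (λ x → f x - g x)            ≡⟨ Σ-cong xs (λ x → minus (f x) (g x)) ⟩
    Σ xs (λ x → f x + (- 1ℤ) * g x)   ≡⟨ p ⊕ ((- 1ℤ) ⊛ q) ⟩
    s + (- 1ℤ) * t                    ≡⟨ minus s t ⟨
    s - t                             ∎
    where
    open ≡-Reasoning
    minus : ∀ a b → a - b ≡ a + (- 1ℤ) * b
    minus = solve-∀

  Σ-via : ∀ {xs : List A} {f g s t} → (∀ {x} → x ∈ xs → f x ≡ g x) → Σ xs g ≡ s → s ≡ t → Σ xs f ≡ t
  Σ-via {xs = xs} eq p q = trans (Σ-cong-∈ xs eq) (trans p q)

  -- Evaluated sums as values: in long linear combinations the implicit summands of _⊕_ would add up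
  -- to terms of quadratic size.
  record Summed (xs : List A) : Set where
    constructor ⟪_⟫
    field
      {summand} : A → ℤ
      {total}   : ℤ
      equation  : Σ xs summand ≡ total

  open Summed public

  infixl 6 _⊞_ _⊟_
  infixr 7 _⊡_

  _⊞_ _⊟_ : ∀ {xs : List A} → Summed xs → Summed xs → Summed xs
  s ⊞ t = ⟪ equation s ⊕ equation t ⟫
  s ⊟ t = ⟪ equation s ⊖ equation t ⟫

  _⊡_ : ∀ {xs : List A} → ℤ → Summed xs → Summed xs
  c ⊡ s = ⟪ c ⊛ equation s ⟫

  Σ-linear : ∀ {xs : List A} {f} (s : Summed xs) → (∀ {x} → x ∈ xs → f x ≡ summand s x) → Σ xs f ≡ total s
  Σ-linear s eq = Σ-via eq (equation s) refl

  Σ-*ʳ : ∀ (xs : List A) (f : A → ℤ) c → Σ xs (λ x → f x * c) ≡ Σ xs f * c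
  Σ-*ʳ xs f c = Σ-via (λ {x} _ → *-comm (f x) c) (c ⊛ refl) (*-comm c (Σ xs f))

  Σ-swap : ∀ (xs : List A) (ys : List B) (f : A → B → ℤ) →
           Σ xs (λ x → Σ ys (f x)) ≡ Σ ys (λ y → Σ xs λ x → f x y)
  Σ-swap []       ys f = trans Σ-[] (sym (trans (Σ-cong ys λ _ → Σ-[]) (Σ-zero ys)))
  Σ-swap (x ∷ xs) ys f = begin
    Σ (x ∷ xs) (λ x → Σ ys (f x))                  ≡⟨ Σ-∷ ⟩
    Σ ys (f x) + Σ xs (λ x → Σ ys (f x))           ≡⟨ cong (Σ ys (f x) +_) (Σ-swap xs ys f) ⟩
    Σ ys (f x) + Σ ys (λ y → Σ xs λ x → f x y)     ≡⟨ refl ⊕ refl ⟨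
    Σ ys (λ y → f x y + Σ xs λ x → f x y)          ≡⟨ Σ-cong ys (λ _ → Σ-∷) ⟨
    Σ ys (λ y → Σ (x ∷ xs) λ x → f x y)            ∎
    where open ≡-Reasoning

  -- Each unordered pair of distinct positions contributes both of its orders, which together with the
  -- diagonal make up the full double sum.
  Σ-pairs : ∀ (xs : List A) (f : A → A → ℤ) →
            Σ (pairs xs) (λ (x , y) → f x y + f y x) ≡ Σ xs (λ x → Σ xs (f x)) - Σ xs (λ x → f x x)
  Σ-pairs []       f = trans Σ-[] (sym (cong₂ _-_ Σ-[] Σ-[]))
  Σ-pairs (x ∷ xs) f = begin
    Σ (map (x ,_) xs ++ pairs xs) (λ (x , y) → f x y + f y x)
      ≡⟨ trans (Σ-++ (map (x ,_) xs) (pairs xs)) (cong₂ _+_ (Σ-map (x ,_) xs) (Σ-pairs xs f)) ⟩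
    Σ xs (λ y → f x y + f y x) + (Σ xs (λ y → Σ xs (f y)) - Σ xs (λ y → f y y))
      ≡⟨ cong (_+ _) (refl ⊕ refl) ⟩
    Σ xs (f x) + Σ xs (λ y → f y x) + (Σ xs (λ y → Σ xs (f y)) - Σ xs (λ y → f y y))
      ≡⟨ arrange (f x x) (Σ xs (f x)) (Σ xs (λ y → f y x)) (Σ xs (λ y → Σ xs (f y))) (Σ xs (λ y → f y y)) ⟩
    (f x x + Σ xs (f x)) + (Σ xs (λ y → f y x) + Σ xs (λ y → Σ xs (f y))) - (f x x + Σ xs (λ y → f y y))
      ≡⟨ cong₂ _-_ (cong₂ _+_ Σ-∷ (trans (Σ-cong xs λ _ → Σ-∷) (refl ⊕ refl))) Σ-∷ ⟨
    Σ (x ∷ xs) (f x) + Σ xs (λ y → Σ (x ∷ xs) (f y)) - Σ (x ∷ xs) (λ y → f y y)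
      ≡⟨ cong (_- Σ (x ∷ xs) (λ y → f y y)) Σ-∷ ⟨
    Σ (x ∷ xs) (λ y → Σ (x ∷ xs) (f y)) - Σ (x ∷ xs) (λ y → f y y)
      ∎
    where
    open ≡-Reasoning
    arrange : ∀ a b c d e → b + c + (d - e) ≡ (a + b) + (c + d) - (a + e)
    arrange = solve-∀

  pairs-distinct : ∀ {P : Pred A 0ℓ} {xs} → Unique xs → All P xs →
                   All (λ (x , y) → P x × P y × x ≢ y) (pairs xs)
  pairs-distinct []       []         = []
  pairs-distinct (x∉ ∷ u) (px ∷ pxs) =
    All.++⁺ (All.map⁺ (All.zipWith (λ (py , x≢y) → px , py , x≢y) (pxs , x∉))) (pairs-distinct u pxs)

  Σ-δ : ∀ {n} (u : Fin n) (f : Fin n → ℤ) → Σ (allFin n) (λ x → ⟦ u Fin.≟ x ⟧ * f x) ≡ f u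
  Σ-δ {suc n} u f = trans Σ-∷ (trans
    -- The tail of `allFin (suc n)` computes to a tabulation of `suc`; `map-tabulate` turns it into
    -- `map suc (allFin n)`, to which `Σ-map` applies.
    (cong (λ xs → ⟦ u Fin.≟ zero ⟧ * f zero + Σ xs (λ x → ⟦ u Fin.≟ x ⟧ * f x)) (sym (map-tabulate (λ x → x) suc)))
    (trans (cong (⟦ u Fin.≟ zero ⟧ * f zero +_) (Σ-map suc (allFin n))) (tail u)))
    where
    tail : ∀ u → ⟦ u Fin.≟ zero ⟧ * f zero + Σ (allFin n) (λ x → ⟦ u Fin.≟ suc x ⟧ * f (suc x)) ≡ f u
    tail zero    = trans
      (cong₂ _+_ (*-identityˡ (f zero)) (trans (Σ-cong (allFin n) λ x → *-zeroˡ (f (suc x))) (Σ-zero (allFin n))))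
      (+-identityʳ (f zero))
    tail (suc u) = trans
      (cong₂ _+_ (*-zeroˡ (f zero)) (trans
        (Σ-cong (allFin n) λ x → cong (_* f (suc x))
          (⟦⟧-cong (suc u Fin.≟ suc x) (u Fin.≟ x) (λ { refl → refl }) (λ { refl → refl })))
        (Σ-δ u (f ∘ suc))))
      (+-identityˡ (f (suc u)))

  -- Counting pairwise related sublists by a marked entry.

  filter-map-∷ : ∀ {P : Pred A 0ℓ} (P? : Decidable₁ P) {x} (xss : List (List A)) → P x →
                 filter (All.all? P?) (map (x ∷_) xss) ≡ map (x ∷_) (filter (All.all? P?) xss)
  filter-map-∷ P? []         px = refl
  filter-map-∷ P? {x} (xs ∷ xss) px with P? x | All.all? P? xs
  ... | no ¬px | _     = contradiction px ¬px
  ... | yes _  | yes _ = cong ((x ∷ xs) ∷_) (filter-map-∷ P? xss px)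
  ... | yes _  | no  _ = filter-map-∷ P? xss px

  -- Used with the predicate "related to `x`": the restriction on what may follow `x` moves from
  -- whole sublists to single entries, so the count recurs on a shorter list of the same kind.
  filter-sublists : ∀ {P : Pred A 0ℓ} (P? : Decidable₁ P) k xs →
                    filter (All.all? P?) (sublists k xs) ≡ sublists k (filter P? xs)
  filter-sublists P? zero    xs       = refl
  filter-sublists P? (suc k) []       = refl
  filter-sublists P? (suc k) (x ∷ xs) with P? x
  ... | yes px = trans (filter-++ (All.all? P?) (map (x ∷_) (sublists k xs)) _)
    (cong₂ _++_ (trans (filter-map-∷ P? (sublists k xs) px) (cong (map (x ∷_)) (filter-sublists P? k xs)))
                (filter-sublists P? (suc k) xs))
  ... | no ¬px = trans (filter-++ (All.all? P?) (map (x ∷_) (sublists k xs)) _)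
    (cong₂ _++_ (filter-none (All.all? P?) (All.map⁺ (All.universal (λ { _ (px ∷ _) → ¬px px }) (sublists k xs))))
                (filter-sublists P? (suc k) xs))

  filter-swap : ∀ {P Q : Pred A 0ℓ} (P? : Decidable₁ P) (Q? : Decidable₁ Q) xs →
                filter P? (filter Q? xs) ≡ filter Q? (filter P? xs)
  filter-swap P? Q? []       = refl
  filter-swap P? Q? (x ∷ xs) with P? x in p | Q? x in q
  ... | yes px | yes qx rewrite p | q = cong (x ∷_) (filter-swap P? Q? xs)
  ... | yes px | no ¬qx rewrite q = filter-swap P? Q? xs
  ... | no ¬px | yes qx rewrite p = filter-swap P? Q? xs
  ... | no ¬px | no ¬qx = filter-swap P? Q? xs

  module PairwiseSublists {A : Set} {D : Rel A 0ℓ} (D? : Decidable D)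
                          (D-sym : ∀ {x y} → D x y → D y x) (D-irrefl : ∀ {x} → ¬ D x x) where

    count : ℕ → List A → ℤ
    count k xs = Σ (sublists k xs) λ ys → ⟦ allPairs? D? ys ⟧

    count-zero : ∀ xs → count 0 xs ≡ 1ℤ
    count-zero xs = trans Σ-∷ (cong (1ℤ +_) Σ-[])

    count-∷ : ∀ k x xs → count (suc k) (x ∷ xs) ≡ count k (filter (D? x) xs) + count (suc k) xs
    count-∷ k x xs = trans (Σ-++ (map (x ∷_) (sublists k xs)) _) (cong (_+ count (suc k) xs) (begin
      Σ (map (x ∷_) (sublists k xs)) (λ ys → ⟦ allPairs? D? ys ⟧)                     ≡⟨ Σ-map (x ∷_) (sublists k xs) ⟩
      Σ (sublists k xs) (λ ys → ⟦ allPairs? D? (x ∷ ys) ⟧)                            ≡⟨ Σ-cong (sublists k xs) allPairs-∷ ⟩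
      Σ (sublists k xs) (λ ys → ⟦ All.all? (D? x) ys ⟧ * ⟦ allPairs? D? ys ⟧)         ≡⟨ Σ-filter (All.all? (D? x)) (sublists k xs) ⟨
      Σ (filter (All.all? (D? x)) (sublists k xs)) (λ ys → ⟦ allPairs? D? ys ⟧)       ≡⟨ cong (λ yss → Σ yss _) (filter-sublists (D? x) k xs) ⟩
      count k (filter (D? x) xs)                                                      ∎))
      where
      open ≡-Reasoning
      allPairs-∷ : ∀ ys → ⟦ allPairs? D? (x ∷ ys) ⟧ ≡ ⟦ All.all? (D? x) ys ⟧ * ⟦ allPairs? D? ys ⟧
      allPairs-∷ ys = trans (⟦⟧-cong (allPairs? D? (x ∷ ys)) (All.all? (D? x) ys ×-dec allPairs? D? ys)
                                     (λ { (p ∷ q) → p , q }) (λ (p , q) → p ∷ q))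
                            (⟦⟧-× (All.all? (D? x) ys) (allPairs? D? ys))

    -- The count at `k - 1`, set to 0 at `k = 0`: an empty sublist has no entry to mark. With this
    -- value the recurrences below hold for every `k`.
    countPred : ℕ → List A → ℤ
    countPred zero    _ = 0ℤ
    countPred (suc k)   = count k

    -- Separates the sublists through `y`. They exist only when `y` is related to `x`, and their
    -- other `k - 1` entries must be related to both.
    count-filter-∷ : ∀ k x y ys → count k (filter (D? x) (y ∷ ys)) ≡
                     count k (filter (D? x) ys) + ⟦ D? y x ⟧ * countPred k (filter (D? x) (filter (D? y) ys))
    count-filter-∷ zero    x y ys = trans (count-zero (filter (D? x) (y ∷ ys))) (sym (cong₂ _+_ (count-zero (filter (D? x) ys)) (*-zeroʳ ⟦ D? y x ⟧)))
    count-filter-∷ (suc k) x y ys with D? y x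
    ... | yes yx = begin
      count (suc k) (filter (D? x) (y ∷ ys))                                    ≡⟨ cong (count (suc k)) (filter-accept (D? x) (D-sym yx)) ⟩
      count (suc k) (y ∷ filter (D? x) ys)                                      ≡⟨ count-∷ k y _ ⟩
      count k (filter (D? y) (filter (D? x) ys)) + count (suc k) (filter (D? x) ys)
        ≡⟨ +-comm (count k (filter (D? y) (filter (D? x) ys))) _ ⟩
      count (suc k) (filter (D? x) ys) + count k (filter (D? y) (filter (D? x) ys))
        ≡⟨ cong (λ zs → count (suc k) (filter (D? x) ys) + count k zs) (filter-swap (D? y) (D? x) ys) ⟩
      count (suc k) (filter (D? x) ys) + count k (filter (D? x) (filter (D? y) ys))
        ≡⟨ cong (count (suc k) (filter (D? x) ys) +_) (*-identityˡ _) ⟨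
      count (suc k) (filter (D? x) ys) + 1ℤ * count k (filter (D? x) (filter (D? y) ys))  ∎
      where open ≡-Reasoning
    ... | no ¬yx = trans (cong (count (suc k)) (filter-reject (D? x) (¬yx ∘ D-sym)))
                         (sym (trans (cong (count (suc k) (filter (D? x) ys) +_) (*-zeroˡ (count k (filter (D? x) (filter (D? y) ys))))) (+-identityʳ _)))

    -- Double counting of sublists with a marked entry: without the mark `x`, what is left is a
    -- related sublist of the entries related to `x`.
    count-*-aux : ∀ k xs → ℤ.+ k * count k xs ≡ Σ xs (λ x → countPred k (filter (D? x) xs))
    count-*-aux zero    xs       = trans (*-zeroˡ (count 0 xs)) (sym (Σ-zero xs))
    count-*-aux (suc k) []       = trans (cong (ℤ.+ suc k *_) Σ-[]) (trans (*-zeroʳ (ℤ.+ suc k)) (sym Σ-[]))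
    count-*-aux (suc k) (y ∷ ys) = sym (begin
      Σ (y ∷ ys) (λ x → count k (filter (D? x) (y ∷ ys)))                        ≡⟨ Σ-∷ ⟩
      count k (filter (D? y) (y ∷ ys)) + Σ ys (λ x → count k (filter (D? x) (y ∷ ys)))
        ≡⟨ cong₂ _+_ (cong (count k) (filter-reject (D? y) D-irrefl)) (Σ-cong ys λ x → count-filter-∷ k x y ys) ⟩
      c + Σ ys (λ x → count k (filter (D? x) ys) + ⟦ D? y x ⟧ * countPred k (filter (D? x) (filter (D? y) ys)))
        -- The marks split three ways: `c` has the mark on `y`; the hypothesis for `ys` handles
        -- sublists avoiding `y`; the hypothesis at `k` on the filtered list handles sublists
        -- through `y` with the mark elsewhere.
        ≡⟨ cong (c +_) (sym (count-*-aux (suc k) ys) ⊕ trans (sym (Σ-filter (D? y) ys)) (sym (count-*-aux k (filter (D? y) ys)))) ⟩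
      c + (ℤ.+ suc k * count (suc k) ys + ℤ.+ k * c)                                 ≡⟨ collect (ℤ.+ k) c (count (suc k) ys) ⟩
      (1ℤ + ℤ.+ k) * (c + count (suc k) ys)                                        ≡⟨ cong ((1ℤ + ℤ.+ k) *_) (count-∷ k y ys) ⟨
      ℤ.+ suc k * count (suc k) (y ∷ ys)                                           ∎)
      where
      open ≡-Reasoning
      c = count k (filter (D? y) ys)
      collect : ∀ k c d → c + ((1ℤ + k) * d + k * c) ≡ (1ℤ + k) * (c + d)
      collect = solve-∀

    count-* : ∀ k xs → ℤ.+ suc k * count (suc k) xs ≡ Σ xs (λ x → count k (filter (D? x) xs))
    count-* k = count-*-aux (suc k)

    ♯-length-filter-allPairs : ∀ k xs → ♯ length (filter (allPairs? D?) (sublists k xs)) ≡ count k xs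
    ♯-length-filter-allPairs k xs = begin
      ♯ length (filter (allPairs? D?) (sublists k xs))     ≡⟨ ♯-length (filter (allPairs? D?) (sublists k xs)) ⟩
      Σ (filter (allPairs? D?) (sublists k xs)) (λ _ → 1ℤ) ≡⟨ Σ-filter (allPairs? D?) (sublists k xs) ⟩
      Σ (sublists k xs) (λ ys → ⟦ allPairs? D? ys ⟧ * 1ℤ)  ≡⟨ Σ-cong (sublists k xs) (λ ys → *-identityʳ ⟦ allPairs? D? ys ⟧) ⟩
      count k xs                                           ∎
      where open ≡-Reasoning

  -- Vertex and edge sums through the adjacency matrix.

  module GraphSums {n : ℕ} (G : Graph n) where
    open Graph G

    -- All labels, present in the graph or not. A graph and its vertex-deleted subgraphs thus share
    -- one index list, and absent labels contribute nothing because their adjacency indicators are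
    -- 0.
    V : List (Fin n)
    V = allFin n

    E : List (Edge n)
    E = edges G

    a : Fin n → Fin n → ℤ
    a u v = ⟦ u ~? v ⟧

    -- The adjacency matrix applied to the vector `h`.
    N : (Fin n → ℤ) → Fin n → ℤ
    N h u = Σ V λ v → a u v * h v

    d : Fin n → ℤ
    d v = ♯ deg G v

    a-sym : ∀ u v → a u v ≡ a v u
    a-sym u v = ⟦⟧-cong (u ~? v) (v ~? u) ~-sym ~-sym

    a-irrefl : ∀ u → a u u ≡ 0ℤ
    a-irrefl u = ⟦⟧-false (u ~? u) ~-irrefl

    Σ-vertices : ∀ {f} → Σ (vertices G) f ≡ Σ V λ v → ⟦ v ∈? vertexSet ⟧ * f v
    Σ-vertices = Σ-filter (_∈? vertexSet) V

    -- A neighbour always lies in `vertexSet`, so the adjacency indicator absorbs the membership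
    -- indicator.
    d≡Σa : ∀ v → d v ≡ Σ V (a v)
    d≡Σa v = begin
      d v                                            ≡⟨ ♯-length (filter (v ~?_) (vertices G)) ⟩
      Σ (filter (v ~?_) (vertices G)) (λ _ → 1ℤ)     ≡⟨ trans (Σ-filter (v ~?_) (vertices G)) Σ-vertices ⟩
      Σ V (λ x → ⟦ x ∈? vertexSet ⟧ * (a v x * 1ℤ))  ≡⟨ Σ-cong V absorb ⟩
      Σ V (a v)                                      ∎
      where
      open ≡-Reasoning
      absorb : ∀ x → ⟦ x ∈? vertexSet ⟧ * (a v x * 1ℤ) ≡ a v x
      absorb x with v ~? x
      ... | yes vx = cong (_* 1ℤ) (⟦⟧-true (x ∈? vertexSet) (~⇒∈ (~-sym vx)))
      ... | no  _  = *-zeroʳ ⟦ x ∈? vertexSet ⟧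

    -- The change in the `k`-th power of the degree when `x` loses one neighbour.
    Δ : ℕ → Fin n → ℤ
    Δ k x = (d x - 1ℤ) ^′ k - d x ^′ k

    N-1 : ∀ v → N (λ _ → 1ℤ) v ≡ d v
    N-1 v = trans (Σ-cong V λ x → *-identityʳ (a v x)) (sym (d≡Σa v))

    d-∉ : ∀ {v} → ¬ v ∈ₛ vertexSet → d v ≡ 0ℤ
    d-∉ {v} v∉ = trans (d≡Σa v) (trans (Σ-cong V λ x → ⟦⟧-false (v ~? x) (v∉ ∘ ~⇒∈)) (Σ-zero V))

    -- The exponent is positive because labels outside `vertexSet` have degree 0 and must contribute
    -- 0; a zeroth power would count them.
    ♯M₁^ : ∀ k → ♯ M₁^ G (suc k) ≡ Σ V λ v → d v ^′ suc k
    ♯M₁^ k = begin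
      ♯ M₁^ G (suc k)                                     ≡⟨ ♯-∑ (vertices G) (λ v → deg G v ℕ.^ suc k) ⟩
      Σ (vertices G) (λ v → ♯ (deg G v ℕ.^ suc k))        ≡⟨ Σ-vertices ⟩
      Σ V (λ v → ⟦ v ∈? vertexSet ⟧ * ♯ (deg G v ℕ.^ suc k)) ≡⟨ Σ-cong V absorb ⟩
      Σ V (λ v → d v ^′ suc k)                             ∎
      where
      open ≡-Reasoning
      absorb : ∀ v → ⟦ v ∈? vertexSet ⟧ * ♯ (deg G v ℕ.^ suc k) ≡ d v ^′ suc k
      absorb v = by-cases (v ∈? vertexSet)
        where
        by-cases : (v∈? : Dec (v ∈ₛ vertexSet)) → ⟦ v∈? ⟧ * ♯ (deg G v ℕ.^ suc k) ≡ d v ^′ suc k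
        by-cases (yes _) = trans (*-identityˡ (♯ (deg G v ℕ.^ suc k))) (♯-homo-^ (deg G v) (suc k))
        by-cases (no v∉) = begin
          0ℤ * ♯ (deg G v ℕ.^ suc k)   ≡⟨ *-zeroˡ (♯ (deg G v ℕ.^ suc k)) ⟩
          0ℤ                           ≡⟨ *-zeroˡ (0ℤ ^′ k) ⟨
          0ℤ * 0ℤ ^′ k                  ≡⟨ ^-suc 0ℤ k ⟨
          0ℤ ^′ suc k                   ≡⟨ cong (_^′ suc k) (d-∉ v∉) ⟨
          d v ^′ suc k                  ∎

    ∈E⇒ : ∀ {e} → e ∈ E → proj₁ e Fin.< proj₂ e × proj₁ e ~ proj₂ e
    ∈E⇒ e∈ = proj₂ (∈-filter⁻ (λ (u , v) → (u Fin.<? v) ×-dec (u ~? v)) {xs = cartesianProduct (vertices G) (vertices G)} e∈)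

    Σ-edges : ∀ {f} → Σ E f ≡ Σ V λ x → Σ V λ y → ⟦ (x Fin.<? y) ×-dec (x ~? y) ⟧ * f (x , y)
    Σ-edges {f} = begin
      Σ E f                                                           ≡⟨ Σ-filter (λ (u , v) → (u Fin.<? v) ×-dec (u ~? v)) _ ⟩
      Σ (cartesianProduct (vertices G) (vertices G)) (λ (x , y) → w x y) ≡⟨ Σ-cartesianProduct (vertices G) (vertices G) ⟩
      Σ (vertices G) (λ x → Σ (vertices G) (w x))                     ≡⟨ trans Σ-vertices (Σ-cong V λ x → cong (⟦ x ∈? vertexSet ⟧ *_) Σ-vertices) ⟩
      Σ V (λ x → ⟦ x ∈? vertexSet ⟧ * Σ V λ y → ⟦ y ∈? vertexSet ⟧ * w x y) ≡⟨ Σ-cong V (λ x → sym (⟦ x ∈? vertexSet ⟧ ⊛ refl)) ⟩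
      Σ V (λ x → Σ V λ y → ⟦ x ∈? vertexSet ⟧ * (⟦ y ∈? vertexSet ⟧ * w x y)) ≡⟨ Σ-cong V (λ x → Σ-cong V (absorb x)) ⟩
      Σ V (λ x → Σ V (w x))                                           ∎
      where
      open ≡-Reasoning
      w : Fin n → Fin n → ℤ
      w x y = ⟦ (x Fin.<? y) ×-dec (x ~? y) ⟧ * f (x , y)
      absorb : ∀ x y → ⟦ x ∈? vertexSet ⟧ * (⟦ y ∈? vertexSet ⟧ * w x y) ≡ w x y
      absorb x y with (x Fin.<? y) ×-dec (x ~? y)
      ... | yes (_ , xy) = trans (cong₂ (λ i j → i * (j * (1ℤ * f (x , y)))) (⟦⟧-true (x ∈? vertexSet) (~⇒∈ xy)) (⟦⟧-true (y ∈? vertexSet) (~⇒∈ (~-sym xy))))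
                                 (trans (*-identityˡ _) (*-identityˡ _))
      ... | no _ = lemma ⟦ x ∈? vertexSet ⟧ ⟦ y ∈? vertexSet ⟧ (f (x , y))
        where
        lemma : ∀ i j z → i * (j * (0ℤ * z)) ≡ 0ℤ * z
        lemma = solve-∀

    -- Of the two orientations of an adjacent pair exactly one is increasing and hence listed, so
    -- adding both orientations of each listed edge covers every adjacent ordered pair once.
    Σ-edges-sym : ∀ (h : Fin n → Fin n → ℤ) → Σ E (λ (u , v) → h u v + h v u) ≡ Σ V λ u → Σ V λ v → a u v * h u v
    Σ-edges-sym h = begin
      Σ E (λ (u , v) → h u v + h v u)                                       ≡⟨ refl ⊕ refl ⟩
      Σ E (λ (u , v) → h u v) + Σ E (λ (u , v) → h v u)                     ≡⟨ cong₂ _+_ Σ-edges (trans Σ-edges (Σ-swap V V _)) ⟩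
      Σ V (λ x → Σ V λ y → up x y * h x y) + Σ V (λ x → Σ V λ y → up y x * h x y)
        ≡⟨ refl ⊕ refl ⟨
      Σ V (λ x → Σ V (λ y → up x y * h x y) + Σ V (λ y → up y x * h x y))   ≡⟨ Σ-cong V (λ x → refl ⊕ refl) ⟨
      Σ V (λ x → Σ V λ y → up x y * h x y + up y x * h x y)                 ≡⟨ Σ-cong V (λ x → Σ-cong V λ y → orient x y) ⟩
      Σ V (λ u → Σ V λ v → a u v * h u v)                                   ∎
      where
      open ≡-Reasoning
      up : Fin n → Fin n → ℤ
      up x y = ⟦ (x Fin.<? y) ×-dec (x ~? y) ⟧
      factor : ∀ p q z → p * z + q * z ≡ (p + q) * z
      factor = solve-∀
      up+up : ∀ x y → up x y + up y x ≡ a x y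
      up+up x y with Fin.<-cmp x y
      ... | tri< x<y _ ¬y<x = trans
        (cong₂ _+_ (⟦⟧-cong ((x Fin.<? y) ×-dec (x ~? y)) (x ~? y) proj₂ (x<y ,_))
                   (⟦⟧-false ((y Fin.<? x) ×-dec (y ~? x)) (¬y<x ∘ proj₁)))
        (+-identityʳ (a x y))
      ... | tri≈ ¬x<y refl _ = trans (cong₂ _+_ up≡0 up≡0) (sym (a-irrefl x))
        where up≡0 = ⟦⟧-false ((x Fin.<? x) ×-dec (x ~? x)) (¬x<y ∘ proj₁)
      ... | tri> ¬x<y _ y<x = trans
        (cong₂ _+_ (⟦⟧-false ((x Fin.<? y) ×-dec (x ~? y)) (¬x<y ∘ proj₁))
                   (⟦⟧-cong ((y Fin.<? x) ×-dec (y ~? x)) (x ~? y) (~-sym ∘ proj₂) (λ xy → y<x , ~-sym xy)))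
        (+-identityˡ (a x y))
      orient : ∀ x y → up x y * h x y + up y x * h x y ≡ a x y * h x y
      orient x y = trans (factor (up x y) (up y x) (h x y)) (cong (_* h x y) (up+up x y))

    Σ-edges-bilinear : ∀ (g h : Fin n → ℤ) → Σ E (λ (u , v) → g u * h v + h u * g v) ≡ Σ V λ u → g u * N h u
    Σ-edges-bilinear g h = begin
      Σ E (λ (u , v) → g u * h v + h u * g v)       ≡⟨ Σ-cong E (λ (u , v) → cong (g u * h v +_) (*-comm (h u) (g v))) ⟩
      Σ E (λ (u , v) → g u * h v + g v * h u)       ≡⟨ Σ-edges-sym (λ u v → g u * h v) ⟩
      Σ V (λ u → Σ V λ v → a u v * (g u * h v))     ≡⟨ Σ-cong V (λ u → Σ-via (λ {v} _ → exchange (a u v) (g u) (h v)) (g u ⊛ refl) refl) ⟩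
      Σ V (λ u → g u * N h u)                       ∎
      where
      open ≡-Reasoning
      exchange : ∀ p q r → p * (q * r) ≡ q * (p * r)
      exchange = solve-∀

    -- Handshaking: the vertex `u` is an end of `d u` edges.
    Σ-edges-linear : ∀ (g : Fin n → ℤ) → Σ E (λ (u , v) → g u + g v) ≡ Σ V λ u → d u * g u
    Σ-edges-linear g = begin
      Σ E (λ (u , v) → g u + g v)                   ≡⟨ Σ-cong E (λ (u , v) → cong₂ _+_ (sym (*-identityʳ (g u))) (sym (*-identityˡ (g v)))) ⟩
      Σ E (λ (u , v) → g u * 1ℤ + 1ℤ * g v)         ≡⟨ Σ-edges-bilinear g (λ _ → 1ℤ) ⟩
      Σ V (λ u → g u * N (λ _ → 1ℤ) u)              ≡⟨ Σ-cong V (λ u → trans (cong (g u *_) (N-1 u)) (*-comm (g u) (d u))) ⟩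
      Σ V (λ u → d u * g u)                         ∎
      where open ≡-Reasoning

    -- The adjacency matrix is symmetric: both sides are the same sum over edges.
    N-adjoint : ∀ (g h : Fin n → ℤ) → Σ V (λ u → g u * N h u) ≡ Σ V (λ u → h u * N g u)
    N-adjoint g h = begin
      Σ V (λ u → g u * N h u)                       ≡⟨ Σ-edges-bilinear g h ⟨
      Σ E (λ (u , v) → g u * h v + h u * g v)       ≡⟨ Σ-cong E (λ (u , v) → +-comm (g u * h v) (h u * g v)) ⟩
      Σ E (λ (u , v) → h u * g v + g u * h v)       ≡⟨ Σ-edges-bilinear h g ⟩
      Σ V (λ u → h u * N g u)                       ∎
      where open ≡-Reasoning

  -- Deleting the two ends of an edge.

  filter-filter : ∀ {P Q R : Pred A 0ℓ} (P? : Decidable₁ P) (Q? : Decidable₁ Q) (R? : Decidable₁ R) →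
                  (∀ {x} → R x → P x × Q x) → (∀ {x} → P x → Q x → R x) →
                  ∀ xs → filter Q? (filter P? xs) ≡ filter R? xs
  filter-filter P? Q? R? to from []       = refl
  filter-filter P? Q? R? to from (x ∷ xs) with P? x | R? x
  ... | yes px | yes rx = trans (filter-accept Q? (proj₂ (to rx))) (cong (x ∷_) (filter-filter P? Q? R? to from xs))
  ... | yes px | no ¬rx = trans (filter-reject Q? (¬rx ∘ from px)) (filter-filter P? Q? R? to from xs)
  ... | no ¬px | yes rx = contradiction (proj₁ (to rx)) ¬px
  ... | no ¬px | no ¬rx = filter-filter P? Q? R? to from xs

  module _ {P : Pred (A × B) 0ℓ} {Q : Pred A 0ℓ} {R : Pred B 0ℓ}
           (P? : Decidable₁ P) (Q? : Decidable₁ Q) (R? : Decidable₁ R)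
           (P⇒Q : ∀ {x y} → P (x , y) → Q x) (P⇒R : ∀ {x y} → P (x , y) → R y) where

    filter-map-filter : ∀ x ys → filter P? (map (x ,_) (filter R? ys)) ≡ filter P? (map (x ,_) ys)
    filter-map-filter x []       = refl
    filter-map-filter x (y ∷ ys) with R? y
    ... | no ¬ry = trans (filter-map-filter x ys) (sym (filter-reject P? (¬ry ∘ P⇒R)))
    ... | yes _ with P? (x , y)
    ...   | yes _ = cong ((x , y) ∷_) (filter-map-filter x ys)
    ...   | no  _ = filter-map-filter x ys

    filter-map-none : ∀ {x} → ¬ Q x → ∀ ys → filter P? (map (x ,_) ys) ≡ []
    filter-map-none ¬qx []       = refl
    filter-map-none ¬qx (y ∷ ys) = trans (filter-reject P? (¬qx ∘ P⇒Q)) (filter-map-none ¬qx ys)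

    filter-cartesianProduct : ∀ xs ys → filter P? (cartesianProduct (filter Q? xs) (filter R? ys)) ≡
                                        filter P? (cartesianProduct xs ys)
    filter-cartesianProduct []       ys = refl
    filter-cartesianProduct (x ∷ xs) ys with Q? x
    ... | yes _ = trans (filter-++ P? (map (x ,_) (filter R? ys)) _)
                        (trans (cong₂ _++_ (filter-map-filter x ys) (filter-cartesianProduct xs ys))
                               (sym (filter-++ P? (map (x ,_) ys) _)))
    ... | no ¬qx = trans (filter-cartesianProduct xs ys)
                         (sym (trans (filter-++ P? (map (x ,_) ys) _) (cong (_++ _) (filter-map-none ¬qx ys))))

  -- If `x` lay in `p ∖ x`, removing it again would lower the cardinality, although a second removal
  -- changes nothing.
  x∈p∖y⇒x≢y : ∀ {n} {p : Subset n} {x y} → x ∈ₛ p ∖ y → x ≢ y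
  x∈p∖y⇒x≢y {p = p} {x} x∈ refl = ℕ.<-irrefl (cong ∣_∣ (p─q─q≡p─q p ⁅ x ⁆)) (x∈p⇒∣p-x∣<∣p∣ x∈)

  module _ {n : ℕ} (G : Graph n) where
    open Graph G

    -- Adjacency already implies membership, so the vertex lists can be replaced by all labels. The
    -- edge lists of `G` and of a deleted graph are then filters of one common list.
    edges-allFin : edges G ≡ filter (λ (x , y) → (x Fin.<? y) ×-dec (x ~? y)) (cartesianProduct (allFin n) (allFin n))
    edges-allFin = filter-cartesianProduct _ (_∈? vertexSet) (_∈? vertexSet) (~⇒∈ ∘ proj₂) (~⇒∈ ∘ ~-sym ∘ proj₂) (allFin n) (allFin n)

  -- The girth itself may rise when vertices are deleted, whereas these two exclusions pass to
  -- `G -[ u , v ]` at once, so the formulas for smaller matchings apply there. In `square-free` two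
  -- inequalities suffice for four distinct vertices, since adjacent vertices differ anyway.
  record Girth≥5 {n : ℕ} (G : Graph n) : Set where
    open Graph G
    field
      triangle-free : ∀ {x y z} → x ~ y → y ~ z → ¬ z ~ x
      square-free   : ∀ {w x y z} → w ~ x → x ~ y → y ~ z → w ≢ y → x ≢ z → ¬ z ~ w

  module EdgeDeletion {n : ℕ} (G : Graph n) (u v : Fin n) where
    open Graph G
    open GraphSums G

    H : Graph n
    H = G -[ u , v ]

    open Graph H using () renaming (vertexSet to vertexSetₕ; _~_ to _~ₕ_; _~?_ to _~ₕ?_)

    ∈H⁻ : ∀ {x} → x ∈ₛ vertexSetₕ → x ≢ u × x ≢ v
    ∈H⁻ x∈ = x∈p∖y⇒x≢y (p─q⊆p _ _ x∈) , x∈p∖y⇒x≢y x∈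

    ∈H⁺ : ∀ {x} → x ∈ₛ vertexSet → x ≢ u → x ≢ v → x ∈ₛ vertexSetₕ
    ∈H⁺ x∈ x≢u x≢v = x∈p∧x≢y⇒x∈p-y (x∈p∧x≢y⇒x∈p-y x∈ x≢u) x≢v

    girth≥5 : Girth≥5 G → Girth≥5 H
    girth≥5 g = record
      { triangle-free = λ xy yz zx → triangle-free (proj₁ xy) (proj₁ yz) (proj₁ zx)
      ; square-free   = λ wx xy yz w≢y x≢z zw → square-free (proj₁ wx) (proj₁ xy) (proj₁ yz) w≢y x≢z (proj₁ zw)
      }
      where open Girth≥5 g

    -- Identifies the list left by `count-*` after the choice of `(u , v)` as the edge list of a
    -- graph, which is what allows the recurrence to be iterated.
    edges-H : edges H ≡ filter (disjoint? (u , v)) (edges G)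
    edges-H = begin
      edges H                                                        ≡⟨ edges-allFin H ⟩
      filter (λ (x , y) → (x Fin.<? y) ×-dec (x ~ₕ? y)) VV           ≡⟨ filter-filter _ (disjoint? (u , v)) _ to from VV ⟨
      filter (disjoint? (u , v)) (filter (λ (x , y) → (x Fin.<? y) ×-dec (x ~? y)) VV)
                                                                     ≡⟨ cong (filter (disjoint? (u , v))) (edges-allFin G) ⟨
      filter (disjoint? (u , v)) (edges G)                           ∎
      where
      open ≡-Reasoning
      VV = cartesianProduct V V
      to : ∀ {e : Edge n} → proj₁ e Fin.< proj₂ e × proj₁ e ~ₕ proj₂ e →
           (proj₁ e Fin.< proj₂ e × proj₁ e ~ proj₂ e) × Disjoint (u , v) e
      to (x<y , xy , x∈ , y∈) = (x<y , xy) ,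
        [ [ proj₁ (∈H⁻ x∈) ∘ sym , proj₁ (∈H⁻ y∈) ∘ sym ]′ , [ proj₂ (∈H⁻ x∈) ∘ sym , proj₂ (∈H⁻ y∈) ∘ sym ]′ ]′
      from : ∀ {e : Edge n} → proj₁ e Fin.< proj₂ e × proj₁ e ~ proj₂ e → Disjoint (u , v) e →
             proj₁ e Fin.< proj₂ e × proj₁ e ~ₕ proj₂ e
      from (x<y , xy) dis = x<y , xy ,
        ∈H⁺ (~⇒∈ xy) (dis ∘ inj₁ ∘ inj₁ ∘ sym) (dis ∘ inj₂ ∘ inj₁ ∘ sym) ,
        ∈H⁺ (~⇒∈ (~-sym xy)) (dis ∘ inj₁ ∘ inj₂ ∘ sym) (dis ∘ inj₂ ∘ inj₂ ∘ sym)

    -- Survival is tested on the label alone; for labels outside `vertexSet` the adjacency factor is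
    -- already 0.
    κ? : ∀ x → Dec (¬ x ∈ₑ (u , v))
    κ? x = ¬? (x ∈ₑ? (u , v))

    κ : Fin n → ℤ
    κ x = ⟦ κ? x ⟧

    a-H : ∀ x y → ⟦ x ~ₕ? y ⟧ ≡ κ x * κ y * a x y
    a-H x y = begin
      ⟦ x ~ₕ? y ⟧                          ≡⟨ ⟦⟧-cong (x ~ₕ? y) ((κ? x ×-dec κ? y) ×-dec (x ~? y)) to from ⟩
      ⟦ (κ? x ×-dec κ? y) ×-dec (x ~? y) ⟧ ≡⟨ trans (⟦⟧-× (κ? x ×-dec κ? y) (x ~? y)) (cong (_* a x y) (⟦⟧-× (κ? x) (κ? y))) ⟩
      κ x * κ y * a x y                    ∎
      where
      open ≡-Reasoning
      to : x ~ₕ y → (¬ x ∈ₑ (u , v) × ¬ y ∈ₑ (u , v)) × x ~ y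
      to (xy , x∈ , y∈) = ([ proj₁ (∈H⁻ x∈) , proj₂ (∈H⁻ x∈) ]′ , [ proj₁ (∈H⁻ y∈) , proj₂ (∈H⁻ y∈) ]′) , xy
      from : (¬ x ∈ₑ (u , v) × ¬ y ∈ₑ (u , v)) × x ~ y → x ~ₕ y
      from ((x∉ , y∉) , xy) = xy , ∈H⁺ (~⇒∈ xy) (x∉ ∘ inj₁) (x∉ ∘ inj₂) , ∈H⁺ (~⇒∈ (~-sym xy)) (y∉ ∘ inj₁) (y∉ ∘ inj₂)

  -- Degree sums of the deleted graph under the girth condition.

  module EdgeDeletionSums {n : ℕ} (G : Graph n) (g : Girth≥5 G) (u v : Fin n) (uv : Graph._~_ G u v) where
    open Graph G
    open Girth≥5 g
    open GraphSums G
    open EdgeDeletion G u v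

    dₕ : Fin n → ℤ
    dₕ = GraphSums.d H

    Nₕ : (Fin n → ℤ) → Fin n → ℤ
    Nₕ = GraphSums.N H

    u≢v : u ≢ v
    u≢v refl = ~-irrefl uv

    a-uv : a u v ≡ 1ℤ
    a-uv = ⟦⟧-true (u ~? v) uv

    a-vu : a v u ≡ 1ℤ
    a-vu = ⟦⟧-true (v ~? u) (~-sym uv)

    -- A common neighbour of `u` and `v` would complete a triangle on the edge.
    a-disjoint : ∀ x → a u x * a v x ≡ 0ℤ
    a-disjoint x = trans (sym (⟦⟧-× (u ~? x) (v ~? x)))
                         (⟦⟧-false ((u ~? x) ×-dec (v ~? x)) λ (ux , vx) → triangle-free ux (~-sym vx) (~-sym uv))

    κ-idem : ∀ x → κ x * κ x ≡ κ x
    κ-idem x = ⟦⟧-idem (κ? x)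

    κ≡ : ∀ x → κ x ≡ 1ℤ - ⟦ u Fin.≟ x ⟧ - ⟦ v Fin.≟ x ⟧
    κ≡ x with u Fin.≟ x | v Fin.≟ x
    ... | yes refl | yes v≡u = contradiction (sym v≡u) u≢v
    ... | yes refl | no _    = ⟦⟧-false (κ? u) λ u∉ → u∉ (inj₁ refl)
    ... | no _     | yes refl = ⟦⟧-false (κ? v) λ v∉ → v∉ (inj₂ refl)
    ... | no u≢x   | no v≢x  = ⟦⟧-true (κ? x) [ u≢x ∘ sym , v≢x ∘ sym ]′

    Σ-κ : ∀ f → Σ V (λ x → κ x * f x) ≡ Σ V f - f u - f v
    Σ-κ f = Σ-via (λ {x} _ → trans (cong (_* f x) (κ≡ x)) (expand ⟦ u Fin.≟ x ⟧ ⟦ v Fin.≟ x ⟧ (f x))) (refl ⊖ Σ-δ u f ⊖ Σ-δ v f) refl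
      where
      expand : ∀ p q z → (1ℤ - p - q) * z ≡ z - p * z - q * z
      expand = solve-∀

    -- The number of neighbours of `x` among `u` and `v`: 0 or 1 by `a-disjoint`, and 1 at `u` and
    -- `v` themselves.
    ν : Fin n → ℤ
    ν x = a u x + a v x

    ν-u : ν u ≡ 1ℤ
    ν-u = cong₂ _+_ (a-irrefl u) a-vu

    ν-v : ν v ≡ 1ℤ
    ν-v = cong₂ _+_ a-uv (a-irrefl v)

    d-H : ∀ x → dₕ x ≡ κ x * (d x - ν x)
    d-H x = begin
      dₕ x                                        ≡⟨ GraphSums.d≡Σa H x ⟩
      Σ V (GraphSums.a H x)                                  ≡⟨ Σ-via (λ {y} _ → trans (a-H x y) (*-assoc (κ x) (κ y) (a x y))) (κ x ⊛ Σ-κ (a x)) refl ⟩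
      κ x * (Σ V (a x) - a x u - a x v)            ≡⟨ cong (κ x *_) (cong₂ _-_ (cong₂ _-_ (sym (d≡Σa x)) (a-sym x u)) (a-sym x v)) ⟩
      κ x * (d x - a u x - a v x)                  ≡⟨ cong (κ x *_) (assoc (d x) (a u x) (a v x)) ⟩
      κ x * (d x - ν x)                            ∎
      where
      open ≡-Reasoning
      assoc : ∀ p q r → p - q - r ≡ p - (q + r)
      assoc = solve-∀

    -- Since `ν x` is 0 or 1, a power of the reduced degree is affine in `ν x` with slope `Δ`. This
    -- makes power sums linear in the adjacency indicators.
    d-H-^ : ∀ k x → dₕ x ^′ suc k ≡ κ x * (d x ^′ suc k + ν x * Δ (suc k) x)
    d-H-^ k x = trans (cong (_^′ suc k) (d-H x)) (go (κ? x) (u ~? x) (v ~? x))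
      where
      open ≡-Reasoning
      shift : ∀ p q → 1ℤ * q ≡ 1ℤ * (p + 1ℤ * (q - p))
      shift = solve-∀
      keep : ∀ p q → 1ℤ * p ≡ 1ℤ * (p + 0ℤ * q)
      keep = solve-∀
      one-* : ∀ z → (1ℤ * z) ^′ suc k ≡ 1ℤ * z ^′ suc k
      one-* z = trans (cong (_^′ suc k) (*-identityˡ z)) (sym (*-identityˡ (z ^′ suc k)))
      go : (p : Dec (¬ x ∈ₑ (u , v))) (q : Dec (u ~ x)) (r : Dec (v ~ x)) →
           (⟦ p ⟧ * (d x - (⟦ q ⟧ + ⟦ r ⟧))) ^′ suc k ≡ ⟦ p ⟧ * (d x ^′ suc k + (⟦ q ⟧ + ⟦ r ⟧) * Δ (suc k) x)
      go (no _) q r = begin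
        (0ℤ * z) ^′ suc k       ≡⟨ cong (_^′ suc k) (*-zeroˡ z) ⟩
        0ℤ ^′ suc k             ≡⟨ trans (^-suc 0ℤ k) (*-zeroˡ (0ℤ ^′ k)) ⟩
        0ℤ                     ≡⟨ *-zeroˡ (d x ^′ suc k + (⟦ q ⟧ + ⟦ r ⟧) * Δ (suc k) x) ⟨
        0ℤ * (d x ^′ suc k + (⟦ q ⟧ + ⟦ r ⟧) * Δ (suc k) x)  ∎
        where z = d x - (⟦ q ⟧ + ⟦ r ⟧)
      go (yes _) (yes ux) (yes vx) = contradiction (~-sym uv) (triangle-free ux (~-sym vx))
      go (yes _) (yes _) (no _)  = trans (one-* (d x - 1ℤ)) (shift (d x ^′ suc k) ((d x - 1ℤ) ^′ suc k))
      go (yes _) (no _)  (yes _) = trans (one-* (d x - 1ℤ)) (shift (d x ^′ suc k) ((d x - 1ℤ) ^′ suc k))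
      go (yes _) (no _)  (no _)  = trans (one-* (d x - 0ℤ)) (trans (cong (λ z → 1ℤ * z ^′ suc k) (minus-zero (d x))) (keep (d x ^′ suc k) (Δ (suc k) x)))
        where
        minus-zero : ∀ z → z - 0ℤ ≡ z
        minus-zero = solve-∀

    power-sum : ∀ k → Σ V (λ x → dₕ x ^′ suc k) ≡
                Σ V (λ x → d x ^′ suc k) + N (Δ (suc k)) u + N (Δ (suc k)) v - (d u - 1ℤ) ^′ suc k - (d v - 1ℤ) ^′ suc k
    power-sum k = begin
      Σ V (λ x → dₕ x ^′ suc k)                          ≡⟨ trans (Σ-cong V (d-H-^ k)) (Σ-κ P) ⟩
      -- The deleted vertices are taken out of the sum. Each is a neighbour of the other, so `ν` is
      -- 1 at both and the removed terms are powers of `d - 1`.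
      Σ V P - P u - P v                                  ≡⟨ cong₂ _-_ (cong₂ _-_ sumP (at u ν-u)) (at v ν-v) ⟩
      Σ V (λ x → d x ^′ suc k) + N (Δ (suc k)) u + N (Δ (suc k)) v - (d u - 1ℤ) ^′ suc k - (d v - 1ℤ) ^′ suc k ∎
      where
      open ≡-Reasoning
      P : Fin n → ℤ
      P x = d x ^′ suc k + ν x * Δ (suc k) x
      cancel : ∀ p q → p + 1ℤ * (q - p) ≡ q
      cancel = solve-∀
      at : ∀ x → ν x ≡ 1ℤ → P x ≡ (d x - 1ℤ) ^′ suc k
      at x eq = trans (cong (λ z → d x ^′ suc k + z * Δ (suc k) x) eq) (cancel (d x ^′ suc k) ((d x - 1ℤ) ^′ suc k))
      split : ∀ p q r z → p + (q + r) * z ≡ p + q * z + r * z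
      split = solve-∀
      sumP : Σ V P ≡ Σ V (λ x → d x ^′ suc k) + N (Δ (suc k)) u + N (Δ (suc k)) v
      sumP = Σ-via (λ {x} _ → split (d x ^′ suc k) (a u x) (a v x) (Δ (suc k) x)) (refl ⊕ refl ⊕ refl) refl

    S : Fin n → ℤ
    S = N d

    -- `σ x` adds up the original degrees of the surviving neighbours of `x`; `τ x` counts those
    -- surviving neighbours that have themselves lost a neighbour. Their difference is the
    -- neighbour-degree sum in the deleted graph at a surviving `x`.
    σ τ : Fin n → ℤ
    σ x = S x - a u x * d u - a v x * d v
    τ x = Σ V λ y → κ y * (a x y * ν y)

    Σκad≡σ : ∀ x → Σ V (λ y → κ y * (a x y * d y)) ≡ σ x
    Σκad≡σ x = trans (Σ-κ (λ y → a x y * d y)) (cong₂ (λ p q → S x - p * d u - q * d v) (a-sym x u) (a-sym x v))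

    N-H : ∀ x → Nₕ dₕ x ≡ κ x * σ x - κ x * τ x
    N-H x = Σ-via (λ {y} _ → trans (cong₂ _*_ (a-H x y) (d-H y)) (term y)) ((κ x ⊛ Σκad≡σ x) ⊖ (κ x ⊛ refl)) refl
      where
      arrange : ∀ p q r s t → p * q * r * (q * (s - t)) ≡ p * ((q * q) * (r * s)) - p * ((q * q) * (r * t))
      arrange = solve-∀
      term : ∀ y → κ x * κ y * a x y * (κ y * (d y - ν y)) ≡ κ x * (κ y * (a x y * d y)) - κ x * (κ y * (a x y * ν y))
      term y = trans (arrange (κ x) (κ y) (a x y) (d y) (ν y))
                     (cong (λ q → κ x * (q * (a x y * d y)) - κ x * (q * (a x y * ν y))) (κ-idem y))

    -- An edge joining neighbours of u or v would close a triangle or a quadrilateral with uv.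
    κνκaν≡0 : ∀ x y → κ x * ν x * (κ y * (a x y * ν y)) ≡ 0ℤ
    κνκaν≡0 x y = begin
      κ x * ν x * (κ y * (a x y * ν y))   ≡⟨ expand (κ x) (κ y) (a x y) (a u x) (a v x) (a u y) (a v y) ⟩
      κ x * κ y * a x y * a u x * a u y + κ x * κ y * a x y * a u x * a v y +
      κ x * κ y * a x y * a v x * a u y + κ x * κ y * a x y * a v x * a v y
        ≡⟨ cong₂ _+_ (cong₂ _+_ (cong₂ _+_
             (vanish (u ~? x) (u ~? y) λ (_ , _ , xy , ux , uy) → triangle-free ux xy (~-sym uy))
             (vanish (u ~? x) (v ~? y) λ (x∉ , y∉ , xy , ux , vy) →
                square-free ux xy (~-sym vy) (y∉ ∘ inj₁ ∘ sym) (x∉ ∘ inj₂) (~-sym uv)))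
             (vanish (v ~? x) (u ~? y) λ (x∉ , y∉ , xy , vx , uy) →
                square-free vx xy (~-sym uy) (y∉ ∘ inj₂ ∘ sym) (x∉ ∘ inj₁) uv))
             (vanish (v ~? x) (v ~? y) λ (_ , _ , xy , vx , vy) → triangle-free vx xy (~-sym vy)) ⟩
      0ℤ                                  ∎
      where
      open ≡-Reasoning
      expand : ∀ p q r s t w z → p * (s + t) * (q * (r * (w + z))) ≡
               p * q * r * s * w + p * q * r * s * z + p * q * r * t * w + p * q * r * t * z
      expand = solve-∀
      vanish : {P Q : Set} (p? : Dec P) (q? : Dec Q) → ¬ (¬ x ∈ₑ (u , v) × ¬ y ∈ₑ (u , v) × x ~ y × P × Q) →
               κ x * κ y * a x y * ⟦ p? ⟧ * ⟦ q? ⟧ ≡ 0ℤ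
      vanish p? q? absurd = begin
        κ x * κ y * a x y * ⟦ p? ⟧ * ⟦ q? ⟧    ≡⟨ assoc (κ x) (κ y) (a x y) ⟦ p? ⟧ ⟦ q? ⟧ ⟩
        κ x * (κ y * (a x y * (⟦ p? ⟧ * ⟦ q? ⟧)))
          ≡⟨ cong (λ z → κ x * (κ y * z)) (trans (cong (a x y *_) (sym (⟦⟧-× p? q?))) (sym (⟦⟧-× (x ~? y) (p? ×-dec q?)))) ⟩
        κ x * (κ y * ⟦ (x ~? y) ×-dec p? ×-dec q? ⟧)
          ≡⟨ trans (cong (κ x *_) (sym (⟦⟧-× (κ? y) ((x ~? y) ×-dec p? ×-dec q?)))) (sym (⟦⟧-× (κ? x) (κ? y ×-dec (x ~? y) ×-dec p? ×-dec q?))) ⟩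
        ⟦ κ? x ×-dec κ? y ×-dec (x ~? y) ×-dec p? ×-dec q? ⟧
          ≡⟨ ⟦⟧-false (κ? x ×-dec κ? y ×-dec (x ~? y) ×-dec p? ×-dec q?) absurd ⟩
        0ℤ                                     ∎
        where
        assoc : ∀ p q r s t → p * q * r * s * t ≡ p * (q * (r * (s * t)))
        assoc = solve-∀

    κντ≡0 : ∀ x → κ x * ν x * τ x ≡ 0ℤ
    κντ≡0 x = trans (sym ((κ x * ν x) ⊛ refl)) (trans (Σ-cong V (κνκaν≡0 x)) (Σ-zero V))

    -- Both are the sum over adjacent surviving pairs with weight `d` at one end and `ν` at the
    -- other.
    Σκdτ≡Σκνσ : Σ V (λ x → κ x * (d x * τ x)) ≡ Σ V (λ x → κ x * (ν x * σ x))
    Σκdτ≡Σκνσ = begin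
      Σ V (λ x → κ x * (d x * τ x))                                 ≡⟨ Σ-cong V (λ x → trans (sym (*-assoc (κ x) (d x) (τ x))) (sym ((κ x * d x) ⊛ refl))) ⟩
      Σ V (λ x → Σ V λ y → κ x * d x * (κ y * (a x y * ν y)))       ≡⟨ Σ-swap V V _ ⟩
      Σ V (λ y → Σ V λ x → κ x * d x * (κ y * (a x y * ν y)))
        ≡⟨ Σ-cong V (λ y → Σ-via (λ {x} _ → trans (cong (λ z → κ x * d x * (κ y * (z * ν y))) (a-sym x y))
                                                    (arrange (κ x) (d x) (κ y) (a y x) (ν y)))
                                   ((κ y * ν y) ⊛ Σκad≡σ y) (*-assoc (κ y) (ν y) (σ y))) ⟩
      Σ V (λ y → κ y * (ν y * σ y))                                 ∎
      where
      open ≡-Reasoning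
      arrange : ∀ p q r s t → p * q * (r * (s * t)) ≡ r * t * (p * (s * q))
      arrange = solve-∀

    σ-u : σ u ≡ S u - d v
    σ-u = trans (cong₂ (λ p q → S u - p * d u - q * d v) (a-irrefl u) a-vu) (simplify (S u) (d u) (d v))
      where
      simplify : ∀ s p q → s - 0ℤ * p - 1ℤ * q ≡ s - q
      simplify = solve-∀

    σ-v : σ v ≡ S v - d u
    σ-v = trans (cong₂ (λ p q → S v - p * d u - q * d v) a-uv (a-irrefl v)) (simplify (S v) (d u) (d v))
      where
      simplify : ∀ s p q → s - 1ℤ * p - 0ℤ * q ≡ s - p
      simplify = solve-∀

    Σκdσ : Σ V (λ x → κ x * (d x * σ x)) ≡
           Σ V (λ x → d x * S x) - d u * S u - d v * S v - d u * (S u - d v) - d v * (S v - d u)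
    Σκdσ = trans (Σ-κ (λ x → d x * σ x))
      (cong₂ _-_ (cong₂ _-_ (Σ-via (λ {x} _ → arrange (d x) (S x) (a u x) (a v x) (d u) (d v)) (refl ⊖ d u ⊛ refl ⊖ d v ⊛ refl) refl)
                            (cong (d u *_) σ-u)) (cong (d v *_) σ-v))
      where
      arrange : ∀ p s q r x y → p * (s - q * x - r * y) ≡ p * s - x * (q * p) - y * (r * p)
      arrange = solve-∀

    Σκνσ : Σ V (λ x → κ x * (ν x * σ x)) ≡
           N S u + N S v - d u * d u - d v * d v - (S u - d v) - (S v - d u)
    Σκνσ = trans (Σ-κ (λ x → ν x * σ x))
      (cong₂ _-_ (cong₂ _-_ (Σ-via (λ {x} _ → term x) (refl ⊕ refl ⊖ d u ⊛ sym (d≡Σa u) ⊖ d v ⊛ sym (d≡Σa v)) refl)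
                            (trans (cong₂ _*_ ν-u σ-u) (*-identityˡ (S u - d v)))) (trans (cong₂ _*_ ν-v σ-v) (*-identityˡ (S v - d u))))
      where
      arrange : ∀ s q r x y → (q + r) * (s - q * x - r * y) ≡ q * s + r * s - x * (q * q) - y * (r * r) - (x + y) * (q * r)
      arrange = solve-∀
      drop : ∀ p q → p - q * 0ℤ ≡ p
      drop = solve-∀
      -- Squares of indicators collapse, and the mixed product `a u x * a v x` is 0 since there are
      -- no triangles.
      term : ∀ x → ν x * σ x ≡ a u x * S x + a v x * S x - d u * a u x - d v * a v x
      term x = trans (arrange (S x) (a u x) (a v x) (d u) (d v))
        (trans (cong₂ _-_ (cong₂ (λ p q → a u x * S x + a v x * S x - d u * p - d v * q) (⟦⟧-idem (u ~? x)) (⟦⟧-idem (v ~? x)))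
                          (cong ((d u + d v) *_) (a-disjoint x)))
               (drop _ (d u + d v)))

    -- Expand `(d - ν) * (σ - τ)` on surviving vertices. The product `ν τ` vanishes because no
    -- surviving edge has two ends that lost a neighbour, and the two cross terms have equal sums,
    -- hence the double subtraction. Every edge is counted twice.
    edge-product-sum : Σ V (λ x → dₕ x * Nₕ dₕ x) ≡
      Σ V (λ x → d x * S x) - ℤ.+ 2 * (d u * S u + d v * S v) + ℤ.+ 2 * (d u * d v)
      - ℤ.+ 2 * (N S u + N S v - d u ^′ 2 - d v ^′ 2 - (S u + S v) + (d u + d v))
    edge-product-sum = Σ-via (λ {x} _ → term x) (Σκdσ ⊖ Σκνσ ⊖ trans Σκdτ≡Σκνσ Σκνσ)
        (collect (Σ V (λ x → d x * S x)) (d u) (d v) (S u) (S v) (N S u) (N S v))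
      where
      open ≡-Reasoning
      expand : ∀ p q r s t → p * (q - r) * (p * s - p * t) ≡ (p * p) * (q * s) - (p * p) * (r * s) - (p * p) * (q * t) + p * (p * r * t)
      expand = solve-∀
      drop : ∀ p q → p + q * 0ℤ ≡ p
      drop = solve-∀
      term : ∀ x → dₕ x * Nₕ dₕ x ≡ κ x * (d x * σ x) - κ x * (ν x * σ x) - κ x * (d x * τ x)
      term x = begin
        dₕ x * Nₕ dₕ x                                                     ≡⟨ cong₂ _*_ (d-H x) (N-H x) ⟩
        κ x * (d x - ν x) * (κ x * σ x - κ x * τ x)                           ≡⟨ expand (κ x) (d x) (ν x) (σ x) (τ x) ⟩
        (κ x * κ x) * (d x * σ x) - (κ x * κ x) * (ν x * σ x) - (κ x * κ x) * (d x * τ x) + κ x * (κ x * ν x * τ x)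
          ≡⟨ cong₂ (λ p q → p * (d x * σ x) - p * (ν x * σ x) - p * (d x * τ x) + κ x * q) (κ-idem x) (κντ≡0 x) ⟩
        κ x * (d x * σ x) - κ x * (ν x * σ x) - κ x * (d x * τ x) + κ x * 0ℤ  ≡⟨ drop _ (κ x) ⟩
        κ x * (d x * σ x) - κ x * (ν x * σ x) - κ x * (d x * τ x)             ∎
      collect : ∀ D x y s t p q →
        (D - x * s - y * t - x * (s - y) - y * (t - x)) - (p + q - x * x - y * y - (s - y) - (t - x)) - (p + q - x * x - y * y - (s - y) - (t - x)) ≡
        D - ℤ.+ 2 * (x * s + y * t) + ℤ.+ 2 * (x * y) - ℤ.+ 2 * (p + q - x ^′ 2 - y ^′ 2 - (s + t) + (x + y))
      collect = solve-∀

  -- Degree sums of one graph expressed by its named invariants.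

  module Invariants {n : ℕ} (G : Graph n) where
    open GraphSums G public

    S : Fin n → ℤ
    S = N d

    m T : ℤ
    m = ♯ size G
    T = Σ V λ u → S u * S u

    Σ-1 : Σ E (λ _ → 1ℤ) ≡ m
    Σ-1 = sym (♯-length E)

    ΣV-d^ : ∀ k → Σ V (λ v → d v ^′ suc k) ≡ ♯ M₁^ G (suc k)
    ΣV-d^ k = sym (♯M₁^ k)

    ΣV-d : Σ V d ≡ ℤ.+ 2 * m
    ΣV-d = begin
      Σ V d                       ≡⟨ Σ-cong V (λ u → *-identityʳ (d u)) ⟨
      Σ V (λ u → d u * 1ℤ)        ≡⟨ Σ-edges-linear (λ _ → 1ℤ) ⟨
      Σ E (λ _ → 1ℤ + 1ℤ)         ≡⟨ Σ-1 ⊕ Σ-1 ⟩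
      m + m                       ≡⟨ double m ⟩
      ℤ.+ 2 * m                     ∎
      where
      open ≡-Reasoning
      double : ∀ x → x + x ≡ ℤ.+ 2 * x
      double = solve-∀

    Σ-d^ : ∀ k → Σ E (λ (u , v) → d u ^′ suc k + d v ^′ suc k) ≡ ♯ M₁^ G (suc (suc k))
    Σ-d^ k = trans (Σ-edges-linear λ u → d u ^′ suc k)
                   (trans (Σ-cong V λ u → sym (^-suc (d u) (suc k))) (ΣV-d^ (suc k)))

    Σ-dd : Σ E (λ (u , v) → d u * d v) ≡ ♯ M₂ G
    Σ-dd = sym (trans (♯-∑ E _) (Σ-cong E λ (u , v) → ♯-homo-* (deg G u) (deg G v)))

    Σ-d²d² : Σ E (λ (u , v) → d u ^′ 2 * d v ^′ 2) ≡ ♯ M₂^ G 2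
    Σ-d²d² = sym (trans (♯-∑ E _) (Σ-cong E λ (u , v) →
      trans (♯-homo-* (deg G u ℕ.^ 2) (deg G v ℕ.^ 2)) (cong₂ _*_ (♯-homo-^ (deg G u) 2) (♯-homo-^ (deg G v) 2))))

    Σ-α : ∀ l → Σ E (λ (u , v) → d u * d v * (d u ^′ l + d v ^′ l)) ≡ ♯ α G l
    Σ-α l = sym (trans (♯-∑ E _) (Σ-cong E λ (u , v) →
      trans (♯-homo-* (deg G u ℕ.* deg G v) _)
            (cong₂ _*_ (♯-homo-* (deg G u) (deg G v))
                       (trans (♯-homo-+ (deg G u ℕ.^ l) _) (cong₂ _+_ (♯-homo-^ (deg G u) l) (♯-homo-^ (deg G v) l))))))

    ΣV-dS : Σ V (λ u → d u * S u) ≡ ℤ.+ 2 * ♯ M₂ G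
    ΣV-dS = begin
      Σ V (λ u → d u * S u)                        ≡⟨ Σ-edges-bilinear d d ⟨
      Σ E (λ (u , v) → d u * d v + d u * d v)      ≡⟨ Σ-dd ⊕ Σ-dd ⟩
      ♯ M₂ G + ♯ M₂ G                              ≡⟨ double (♯ M₂ G) ⟩
      ℤ.+ 2 * ♯ M₂ G                                 ∎
      where
      open ≡-Reasoning
      double : ∀ x → x + x ≡ ℤ.+ 2 * x
      double = solve-∀

    ΣV-d^S : ∀ l → Σ V (λ u → d u ^′ suc l * S u) ≡ ♯ α G l
    ΣV-d^S l = trans (sym (Σ-edges-bilinear (λ u → d u ^′ suc l) d)) (trans (Σ-cong E λ (u , v) → begin
      d u ^′ suc l * d v + d u * d v ^′ suc l            ≡⟨ cong₂ (λ p q → p * d v + d u * q) (^-suc (d u) l) (^-suc (d v) l) ⟩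
      d u * d u ^′ l * d v + d u * (d v * d v ^′ l)      ≡⟨ arrange (d u) (d v) (d u ^′ l) (d v ^′ l) ⟩
      d u * d v * (d u ^′ l + d v ^′ l)                  ∎) (Σ-α l))
      where
      open ≡-Reasoning
      arrange : ∀ x y p q → x * p * y + x * (y * q) ≡ x * y * (p + q)
      arrange = solve-∀

    ΣV-d²S : Σ V (λ u → d u * (d u * S u)) ≡ ♯ α G 1
    ΣV-d²S = trans (Σ-cong V λ u → sym (*-assoc (d u) (d u) (S u))) (ΣV-d^S 1)

    -- As `S` is `N d`, adjointness turns the pairing of `d` with `N (N d)` into the square sum of
    -- `N d`.
    ΣV-dNS : Σ V (λ u → d u * N S u) ≡ T
    ΣV-dNS = N-adjoint d S

    Σ-S : Σ E (λ (u , v) → S u + S v) ≡ ℤ.+ 2 * ♯ M₂ G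
    Σ-S = trans (Σ-edges-linear S) ΣV-dS

    Σ-dS : Σ E (λ (u , v) → d u * S u + d v * S v) ≡ ♯ α G 1
    Σ-dS = trans (Σ-edges-linear λ u → d u * S u) ΣV-d²S

    Σ-dS-cross : Σ E (λ (u , v) → d u * S v + S u * d v) ≡ T
    Σ-dS-cross = trans (Σ-edges-bilinear d S) ΣV-dNS

    Σ-NS : Σ E (λ (u , v) → N S u + N S v) ≡ T
    Σ-NS = trans (Σ-edges-linear (N S)) ΣV-dNS

  -- Sums over meeting edges: `EM₂` and `β` as degree sums.

  at-∩ₑ : ∀ {n} {u v x y : Fin n} → u Fin.< v → x Fin.< y → (u , v) ≢ (x , y) → (z : Fin n → ℤ) →
          (⟦ u Fin.≟ x ⟧ * z u + ⟦ v Fin.≟ x ⟧ * z v) + (⟦ u Fin.≟ y ⟧ * z u + ⟦ v Fin.≟ y ⟧ * z v) ≡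
          ⟦ meet? (u , v) (x , y) ⟧ * z ((u , v) ∩ₑ (x , y))
  at-∩ₑ {u = u} {v} {x} {y} u<v x<y e≢f z = go (u Fin.≟ x) (u Fin.≟ y) (v Fin.≟ x) (v Fin.≟ y)
    where
    -- Distinct edges share at most one vertex, so at most one of the four coincidences holds. The
    -- orientations exclude loops and reversed copies, and `e≢f` excludes equal edges.
    go : (p : Dec (u ≡ x)) (q : Dec (u ≡ y)) (r : Dec (v ≡ x)) (s : Dec (v ≡ y)) →
         (⟦ p ⟧ * z u + ⟦ r ⟧ * z v) + (⟦ q ⟧ * z u + ⟦ s ⟧ * z v) ≡
         ⟦ (p ⊎-dec q) ⊎-dec (r ⊎-dec s) ⟧ * z (if does (p ⊎-dec q) then u else v)
    go (yes refl) (yes refl) _          _          = contradiction x<y (Fin.<-irrefl refl)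
    go (yes refl) (no _)     (yes refl) _          = contradiction u<v (Fin.<-irrefl refl)
    go (yes refl) (no _)     (no _)     (yes refl) = contradiction refl e≢f
    go (yes refl) (no _)     (no _)     (no _)     = simplify (z u) (z v)
      where
      simplify : ∀ p q → (1ℤ * p + 0ℤ * q) + (0ℤ * p + 0ℤ * q) ≡ 1ℤ * p
      simplify = solve-∀
    go (no _)     (yes refl) (yes refl) _          = contradiction x<y (Fin.<-asym u<v)
    go (no _)     (yes refl) (no _)     (yes refl) = contradiction u<v (Fin.<-irrefl refl)
    go (no _)     (yes refl) (no _)     (no _)     = simplify (z u) (z v)
      where
      simplify : ∀ p q → (0ℤ * p + 0ℤ * q) + (1ℤ * p + 0ℤ * q) ≡ 1ℤ * p
      simplify = solve-∀
    go (no _)     (no _)     (yes refl) (yes refl) = contradiction x<y (Fin.<-irrefl refl)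
    go (no _)     (no _)     (yes refl) (no _)     = simplify (z u) (z v)
      where
      simplify : ∀ p q → (0ℤ * p + 1ℤ * q) + (0ℤ * p + 0ℤ * q) ≡ 1ℤ * q
      simplify = solve-∀
    go (no _)     (no _)     (no _)     (yes refl) = simplify (z u) (z v)
      where
      simplify : ∀ p q → (0ℤ * p + 0ℤ * q) + (0ℤ * p + 1ℤ * q) ≡ 1ℤ * q
      simplify = solve-∀
    go (no _)     (no _)     (no _)     (no _)     = simplify (z u) (z v)
      where
      simplify : ∀ p q → (0ℤ * p + 0ℤ * q) + (0ℤ * p + 0ℤ * q) ≡ 0ℤ * q
      simplify = solve-∀

  ∈⇒1≤length : ∀ {A : Set} {x : A} {xs} → x ∈ xs → 1 ℕ.≤ length xs
  ∈⇒1≤length (here _)  = ℕ.s≤s ℕ.z≤n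
  ∈⇒1≤length (there _) = ℕ.s≤s ℕ.z≤n

  module MeetingPairs {n : ℕ} (G : Graph n) where
    open Graph G
    open Invariants G

    δ : Fin n → Fin n → ℤ
    δ x y = ⟦ x Fin.≟ y ⟧

    w : Fin n → Fin n → ℤ
    w x y = d x + d y - ℤ.+ 2

    w-sym : ∀ x y → w x y ≡ w y x
    w-sym x y = cong (_- ℤ.+ 2) (+-comm (d x) (d y))

    1≤deg : ∀ {x y} → x ~ y → 1 ℕ.≤ deg G x
    1≤deg {x} {y} xy = ∈⇒1≤length (∈-filter⁺ (x ~?_) (∈-filter⁺ (_∈? vertexSet) (∈-allFin y) (~⇒∈ (~-sym xy))) xy)

    ♯edgeDeg : ∀ {x y} → x ~ y → ♯ edgeDeg G (x , y) ≡ w x y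
    ♯edgeDeg {x} {y} xy = begin
      ♯ k                            ≡⟨ shift (♯ k) ⟩
      ♯ k + ℤ.+ 2 - ℤ.+ 2              ≡⟨ cong (_- ℤ.+ 2) (trans (♯-homo-+ k 2) (cong (♯ k +_) (♯≡+ 2))) ⟨
      ♯ (k ℕ.+ 2) - ℤ.+ 2              ≡⟨ cong (λ j → ♯ j - ℤ.+ 2) (ℕ.m∸n+n≡m (ℕ.+-mono-≤ (1≤deg xy) (1≤deg (~-sym xy)))) ⟩
      ♯ (deg G x ℕ.+ deg G y) - ℤ.+ 2  ≡⟨ cong (_- ℤ.+ 2) (♯-homo-+ (deg G x) (deg G y)) ⟩
      w x y                          ∎
      where
      open ≡-Reasoning
      k = edgeDeg G (x , y)
      shift : ∀ z → z ≡ z + ℤ.+ 2 - ℤ.+ 2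
      shift = solve-∀

    -- Makes pairs of distinct positions pairs of distinct edges, as `k-meet` requires.
    E-unique : Unique E
    E-unique = filter⁺ _ (cartesianProduct⁺ vertices-unique vertices-unique)
      where vertices-unique = filter⁺ (_∈? vertexSet) (allFin⁺ n)

    module _ (g : Fin n → ℤ → ℤ → ℤ) (g-sym : ∀ c s t → g c s t ≡ g c t s) where

      -- Agrees with g at the common vertex of two distinct meeting edges, vanishes on disjoint edges,
      -- but is bilinear in the incidence indicators, so that its double sum over the edges factors.
      k : Edge n → Edge n → ℤ
      k (u , v) (x , y) = (δ u x * g u (w u v) (w x y) + δ v x * g v (w u v) (w x y))
                        + (δ u y * g u (w u v) (w x y) + δ v y * g v (w u v) (w x y))

      δ-exchange : ∀ x y s t → δ x y * g x s t ≡ δ y x * g y t s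
      δ-exchange x y s t with x Fin.≟ y | y Fin.≟ x
      ... | yes refl | yes _ = cong (1ℤ *_) (g-sym x s t)
      ... | yes refl | no x≢x = contradiction refl x≢x
      ... | no x≢y | yes y≡x = contradiction (sym y≡x) x≢y
      ... | no _ | no _ = trans (*-zeroˡ (g x s t)) (sym (*-zeroˡ (g y t s)))

      k-sym : ∀ e f → k e f ≡ k f e
      k-sym (u , v) (x , y) = trans
        (cong₂ _+_ (cong₂ _+_ (δ-exchange u x (w u v) (w x y)) (δ-exchange v x (w u v) (w x y)))
                   (cong₂ _+_ (δ-exchange u y (w u v) (w x y)) (δ-exchange v y (w u v) (w x y))))
        (interchange (δ x u * g x (w x y) (w u v)) (δ x v * g x (w x y) (w u v)) (δ y u * g y (w x y) (w u v)) (δ y v * g y (w x y) (w u v)))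
        where
        interchange : ∀ p q r s → (p + q) + (r + s) ≡ (p + r) + (q + s)
        interchange = solve-∀

      k-meet : ∀ {u v x y} → u Fin.< v → x Fin.< y → (u , v) ≢ (x , y) →
               k (u , v) (x , y) ≡ ⟦ meet? (u , v) (x , y) ⟧ * g ((u , v) ∩ₑ (x , y)) (w u v) (w x y)
      k-meet {u} {v} {x} {y} u<v x<y e≢f = at-∩ₑ u<v x<y e≢f (λ c → g c (w u v) (w x y))

      k-diagonal : ∀ {u v} → u Fin.< v → k (u , v) (u , v) ≡ g u (w u v) (w u v) + g v (w u v) (w u v)
      k-diagonal {u} {v} u<v = trans
        (cong₂ _+_ (cong₂ (λ p q → p * z u + q * z v) (⟦⟧-true (u Fin.≟ u) refl) (⟦⟧-false (v Fin.≟ u) (Fin.<⇒≢ u<v ∘ sym)))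
                   (cong₂ (λ p q → p * z u + q * z v) (⟦⟧-false (u Fin.≟ v) (Fin.<⇒≢ u<v)) (⟦⟧-true (v Fin.≟ v) refl)))
        (simplify (z u) (z v))
        where
        z : Fin n → ℤ
        z c = g c (w u v) (w u v)
        simplify : ∀ p q → (1ℤ * p + 0ℤ * q) + (0ℤ * p + 1ℤ * q) ≡ p + q
        simplify = solve-∀

      -- The contribution of all edges at `u` when paired with `(u , v)`. That edge itself is
      -- included, which is why a diagonal is subtracted later.
      star : Fin n → Fin n → ℤ
      star u v = Σ V λ y → a u y * g u (w u v) (w u y)

      Σ-k : ∀ u v → Σ E (k (u , v)) ≡ star u v + star v u
      Σ-k u v = begin
        -- Up to the symmetry of `w`, the two brackets of `k` are one function taken at `(x , y)`
        -- and at `(y , x)`.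
        Σ E (k (u , v))                                          ≡⟨ Σ-cong E (λ (x , y) → cong (λ z → h x y + (δ u y * g u s z + δ v y * g v s z)) (w-sym x y)) ⟩
        Σ E (λ (x , y) → h x y + h y x)                          ≡⟨ Σ-edges-sym h ⟩
        Σ V (λ x → Σ V λ y → a x y * h x y)
          ≡⟨ Σ-cong V (λ x → Σ-via (λ {y} _ → arrange (a x y) (δ u x) (δ v x) (g u s (w x y)) (g v s (w x y))) (δ u x ⊛ refl ⊕ δ v x ⊛ refl) refl) ⟩
        Σ V (λ x → δ u x * Σ V (λ y → a x y * g u s (w x y)) + δ v x * Σ V (λ y → a x y * g v s (w x y)))
          ≡⟨ Σ-δ u (λ x → Σ V (λ y → a x y * g u s (w x y))) ⊕ Σ-δ v (λ x → Σ V (λ y → a x y * g v s (w x y))) ⟩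
        star u v + Σ V (λ y → a v y * g v s (w v y))             ≡⟨ cong (λ z → star u v + Σ V (λ y → a v y * g v z (w v y))) (w-sym u v) ⟩
        star u v + star v u                                      ∎
        where
        open ≡-Reasoning
        s = w u v
        h : Fin n → Fin n → ℤ
        h x y = δ u x * g u s (w x y) + δ v x * g v s (w x y)
        arrange : ∀ p q r s t → p * (q * s + r * t) ≡ q * (p * s) + r * (p * t)
        arrange = solve-∀

      -- The double sum of `k` over all edges contains each meeting pair in both orders, and also
      -- the diagonal, where an edge meets itself at both ends; the latter is subtracted.
      Σ-meetingPairs : ∀ (f : Edge n × Edge n → ℤ) →
        (∀ {u v x y} → u ~ v → x ~ y → f ((u , v) , (x , y)) ≡ g ((u , v) ∩ₑ (x , y)) (w u v) (w x y)) →
        ℤ.+ 2 * Σ (meetingPairs G) f ≡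
        Σ V (λ u → Σ V λ v → a u v * star u v) - Σ E (λ (u , v) → g u (w u v) (w u v) + g v (w u v) (w u v))
      Σ-meetingPairs f f≡ = begin
        ℤ.+ 2 * Σ (meetingPairs G) f                                              ≡⟨ cong (ℤ.+ 2 *_) (Σ-filter (λ (e , e′) → meet? e e′) (pairs E)) ⟩
        ℤ.+ 2 * Σ (pairs E) (λ (e , e′) → ⟦ meet? e e′ ⟧ * f (e , e′))            ≡⟨ ℤ.+ 2 ⊛ refl ⟨
        Σ (pairs E) (λ (e , e′) → ℤ.+ 2 * (⟦ meet? e e′ ⟧ * f (e , e′)))          ≡⟨ Σ-cong-∈ (pairs E) (λ p∈ → term (All.lookup distinct p∈)) ⟩
        Σ (pairs E) (λ (e , e′) → k e e′ + k e′ e)                              ≡⟨ Σ-pairs E k ⟩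
        Σ E (λ e → Σ E (k e)) - Σ E (λ e → k e e)
          ≡⟨ cong₂ _-_ (trans (Σ-cong E λ (u , v) → Σ-k u v) (Σ-edges-sym star)) (Σ-cong-∈ E λ e∈ → k-diagonal (proj₁ (∈E⇒ e∈))) ⟩
        Σ V (λ u → Σ V λ v → a u v * star u v) - Σ E (λ (u , v) → g u (w u v) (w u v) + g v (w u v) (w u v)) ∎
        where
        open ≡-Reasoning
        IsEdge : Edge n → Set
        IsEdge (u , v) = u Fin.< v × u ~ v
        distinct : All (λ (e , e′) → IsEdge e × IsEdge e′ × e ≢ e′) (pairs E)
        distinct = pairs-distinct E-unique (All.tabulate ∈E⇒)
        double : ∀ x → ℤ.+ 2 * x ≡ x + x
        double = solve-∀
        term : ∀ {p} → IsEdge (proj₁ p) × IsEdge (proj₂ p) × proj₁ p ≢ proj₂ p →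
               ℤ.+ 2 * (⟦ meet? (proj₁ p) (proj₂ p) ⟧ * f p) ≡ k (proj₁ p) (proj₂ p) + k (proj₂ p) (proj₁ p)
        term {e@(u , v) , e′@(x , y)} ((u<v , uv) , (x<y , xy) , e≢e′) = begin
          ℤ.+ 2 * (⟦ meet? e e′ ⟧ * f (e , e′))                      ≡⟨ cong (λ z → ℤ.+ 2 * (⟦ meet? e e′ ⟧ * z)) (f≡ uv xy) ⟩
          ℤ.+ 2 * (⟦ meet? e e′ ⟧ * g (e ∩ₑ e′) (w u v) (w x y))     ≡⟨ cong (ℤ.+ 2 *_) (k-meet u<v x<y e≢e′) ⟨
          ℤ.+ 2 * k e e′                                             ≡⟨ double (k e e′) ⟩
          k e e′ + k e e′                                          ≡⟨ cong (k e e′ +_) (k-sym e e′) ⟩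
          k e e′ + k e′ e                                          ∎

    -- The total edge degree of the edges at `u`.
    W : Fin n → ℤ
    W u = d u ^′ 2 + S u - ℤ.+ 2 * d u

    Σaw≡W : ∀ u → Σ V (λ v → a u v * w u v) ≡ W u
    Σaw≡W u = Σ-via (λ {v} _ → arrange (a u v) (d u) (d v)) (d u ⊛ sym (d≡Σa u) ⊕ refl ⊖ ℤ.+ 2 ⊛ sym (d≡Σa u)) refl
      where
      arrange : ∀ p x y → p * (x + y - ℤ.+ 2) ≡ x * p + p * y - ℤ.+ 2 * p
      arrange = solve-∀

    -- For products of edge degrees, the double sum over edges at `u` factors as `W u * W u`. The
    -- square of `S u` inside it is the source of `T`, so this identity can be used to eliminate
    -- `T`.
    2*EM₂ : ℤ.+ 2 * ♯ EM₂ G ≡ T + ℤ.+ 2 * ♯ α G 1 - ℤ.+ 12 * ♯ M₂ G + ♯ M₁^ G 4 - ℤ.+ 6 * ♯ F G + ℤ.+ 12 * ♯ M₁ G - ℤ.+ 8 * m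
    2*EM₂ = begin
      ℤ.+ 2 * ♯ EM₂ G                                       ≡⟨ cong (ℤ.+ 2 *_) (♯-∑ (meetingPairs G) _) ⟩
      ℤ.+ 2 * Σ (meetingPairs G) (λ (e , f) → ♯ (edgeDeg G e ℕ.* edgeDeg G f))
        ≡⟨ Σ-meetingPairs g (λ _ s t → *-comm s t) _ (λ {u} {v} {x} {y} uv xy →
             trans (♯-homo-* (edgeDeg G (u , v)) (edgeDeg G (x , y))) (cong₂ _*_ (♯edgeDeg uv) (♯edgeDeg xy))) ⟩
      Σ V (λ u → Σ V λ v → a u v * star g (λ _ s t → *-comm s t) u v) - Σ E (λ (u , v) → w u v * w u v + w u v * w u v)
        ≡⟨ cong₂ _-_ (trans (Σ-cong V stars) vertexPart) edgePart ⟩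
      (♯ M₁^ G 4 - ℤ.+ 4 * ♯ F G + ℤ.+ 4 * ♯ M₁ G + T + ℤ.+ 2 * ♯ α G 1 - ℤ.+ 4 * (ℤ.+ 2 * ♯ M₂ G))
      - (ℤ.+ 2 * ♯ F G + ℤ.+ 4 * ♯ M₂ G - ℤ.+ 8 * ♯ M₁ G + ℤ.+ 8 * m)
        ≡⟨ collect (♯ M₁^ G 4) (♯ F G) (♯ M₁ G) T (♯ α G 1) (♯ M₂ G) m ⟩
      T + ℤ.+ 2 * ♯ α G 1 - ℤ.+ 12 * ♯ M₂ G + ♯ M₁^ G 4 - ℤ.+ 6 * ♯ F G + ℤ.+ 12 * ♯ M₁ G - ℤ.+ 8 * m ∎
      where
      open ≡-Reasoning
      g : Fin n → ℤ → ℤ → ℤ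
      g _ s t = s * t
      arrange : ∀ p s q t → p * (s * (q * t)) ≡ s * p * (q * t)
      arrange = solve-∀
      stars : ∀ u → Σ V (λ v → a u v * Σ V λ y → a u y * (w u v * w u y)) ≡ W u * W u
      stars u = begin
        Σ V (λ v → a u v * Σ V λ y → a u y * (w u v * w u y))
          ≡⟨ Σ-cong V (λ v → cong (a u v *_) (Σ-via (λ {y} _ → exchange (a u y) (w u v) (w u y)) (w u v ⊛ Σaw≡W u) refl)) ⟩
        Σ V (λ v → a u v * (w u v * W u))            ≡⟨ Σ-cong V (λ v → *-assoc (a u v) (w u v) (W u)) ⟨
        Σ V (λ v → a u v * w u v * W u)              ≡⟨ Σ-*ʳ V (λ v → a u v * w u v) (W u) ⟩
        Σ V (λ v → a u v * w u v) * W u              ≡⟨ cong (_* W u) (Σaw≡W u) ⟩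
        W u * W u                                    ∎
        where
        exchange : ∀ p q r → p * (q * r) ≡ q * (p * r)
        exchange = solve-∀
      expandW : ∀ x s → (x ^′ 2 + s - ℤ.+ 2 * x) * (x ^′ 2 + s - ℤ.+ 2 * x) ≡
                x ^′ 4 - ℤ.+ 4 * x ^′ 3 + ℤ.+ 4 * x ^′ 2 + s * s + ℤ.+ 2 * (x ^′ 2 * s) - ℤ.+ 4 * (x * s)
      expandW = solve-∀
      vertexPart : Σ V (λ u → W u * W u) ≡ ♯ M₁^ G 4 - ℤ.+ 4 * ♯ F G + ℤ.+ 4 * ♯ M₁ G + T + ℤ.+ 2 * ♯ α G 1 - ℤ.+ 4 * (ℤ.+ 2 * ♯ M₂ G)
      vertexPart = Σ-via (λ {u} _ → expandW (d u) (S u))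
        (ΣV-d^ 3 ⊖ ℤ.+ 4 ⊛ ΣV-d^ 2 ⊕ ℤ.+ 4 ⊛ ΣV-d^ 1 ⊕ refl ⊕ ℤ.+ 2 ⊛ ΣV-d^S 1 ⊖ ℤ.+ 4 ⊛ ΣV-dS) refl
      expandw : ∀ x y → (x + y - ℤ.+ 2) * (x + y - ℤ.+ 2) + (x + y - ℤ.+ 2) * (x + y - ℤ.+ 2) ≡
                ℤ.+ 2 * (x ^′ 2 + y ^′ 2) + ℤ.+ 4 * (x * y) - ℤ.+ 8 * (x + y) + ℤ.+ 8 * 1ℤ
      expandw = solve-∀
      edgePart : Σ E (λ (u , v) → w u v * w u v + w u v * w u v) ≡ ℤ.+ 2 * ♯ F G + ℤ.+ 4 * ♯ M₂ G - ℤ.+ 8 * ♯ M₁ G + ℤ.+ 8 * m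
      edgePart = Σ-via (λ {e} _ → expandw (d (proj₁ e)) (d (proj₂ e)))
        (ℤ.+ 2 ⊛ Σ-d^ 1 ⊕ ℤ.+ 4 ⊛ Σ-dd ⊖ ℤ.+ 8 ⊛ Σ-d^ 0 ⊕ ℤ.+ 8 ⊛ Σ-1) refl
      collect : ∀ M4 F M1 T al M2 m →
        (M4 - ℤ.+ 4 * F + ℤ.+ 4 * M1 + T + ℤ.+ 2 * al - ℤ.+ 4 * (ℤ.+ 2 * M2)) - (ℤ.+ 2 * F + ℤ.+ 4 * M2 - ℤ.+ 8 * M1 + ℤ.+ 8 * m) ≡
        T + ℤ.+ 2 * al - ℤ.+ 12 * M2 + M4 - ℤ.+ 6 * F + ℤ.+ 12 * M1 - ℤ.+ 8 * m
      collect = solve-∀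

    -- The summand is only linear in the edge degrees, so the star sums are linear in `W u`; `S u`
    -- occurs only multiplied by `d u ^′ 2`, which gives `α` and no `T`.
    2*β : ℤ.+ 2 * ♯ β G ≡ ℤ.+ 2 * ♯ α G 1 + ℤ.+ 2 * ♯ M₁^ G 4 - ℤ.+ 6 * ♯ F G - ℤ.+ 4 * ♯ M₂ G + ℤ.+ 4 * ♯ M₁ G
    2*β = begin
      ℤ.+ 2 * ♯ β G                                         ≡⟨ cong (ℤ.+ 2 *_) (♯-∑ (meetingPairs G) _) ⟩
      ℤ.+ 2 * Σ (meetingPairs G) (λ (e , f) → ♯ (deg G (e ∩ₑ f) ℕ.* (edgeDeg G e ℕ.+ edgeDeg G f)))
        ≡⟨ Σ-meetingPairs g g-sym _ (λ {u} {v} {x} {y} uv xy → trans (♯-homo-* (deg G ((u , v) ∩ₑ (x , y))) _)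
             (cong (d ((u , v) ∩ₑ (x , y)) *_) (trans (♯-homo-+ (edgeDeg G (u , v)) (edgeDeg G (x , y))) (cong₂ _+_ (♯edgeDeg uv) (♯edgeDeg xy))))) ⟩
      Σ V (λ u → Σ V λ v → a u v * star g g-sym u v) - Σ E (λ (u , v) → d u * (w u v + w u v) + d v * (w u v + w u v))
        ≡⟨ cong₂ _-_ (trans (Σ-cong V stars) vertexPart) edgePart ⟩
      (ℤ.+ 2 * ♯ M₁^ G 4 + ℤ.+ 2 * ♯ α G 1 - ℤ.+ 4 * ♯ F G) - (ℤ.+ 2 * ♯ F G + ℤ.+ 4 * ♯ M₂ G - ℤ.+ 4 * ♯ M₁ G)
        ≡⟨ collect (♯ M₁^ G 4) (♯ F G) (♯ M₁ G) (♯ α G 1) (♯ M₂ G) ⟩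
      ℤ.+ 2 * ♯ α G 1 + ℤ.+ 2 * ♯ M₁^ G 4 - ℤ.+ 6 * ♯ F G - ℤ.+ 4 * ♯ M₂ G + ℤ.+ 4 * ♯ M₁ G ∎
      where
      open ≡-Reasoning
      g : Fin n → ℤ → ℤ → ℤ
      g c s t = d c * (s + t)
      g-sym : ∀ c s t → g c s t ≡ g c t s
      g-sym c s t = cong (d c *_) (+-comm s t)
      stars : ∀ u → Σ V (λ v → a u v * Σ V λ y → a u y * (d u * (w u v + w u y))) ≡ ℤ.+ 2 * (d u ^′ 2 * W u)
      stars u = begin
        Σ V (λ v → a u v * Σ V λ y → a u y * (d u * (w u v + w u y)))
          ≡⟨ Σ-cong V (λ v → cong (a u v *_) (Σ-via (λ {y} _ → arrange (a u y) (d u) (w u v) (w u y))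
                                                       ((d u * w u v) ⊛ sym (d≡Σa u) ⊕ d u ⊛ Σaw≡W u) refl)) ⟩
        Σ V (λ v → a u v * (d u * w u v * d u + d u * W u))
          ≡⟨ Σ-via (λ {v} _ → arrange′ (a u v) (d u) (w u v) (W u)) ((d u ^′ 2) ⊛ Σaw≡W u ⊕ (d u * W u) ⊛ sym (d≡Σa u)) (double (d u) (W u)) ⟩
        ℤ.+ 2 * (d u ^′ 2 * W u)                        ∎
        where
        arrange : ∀ p x s t → p * (x * (s + t)) ≡ x * s * p + x * (p * t)
        arrange = solve-∀
        arrange′ : ∀ p x s t → p * (x * s * x + x * t) ≡ x ^′ 2 * (p * s) + x * t * p
        arrange′ = solve-∀
        double : ∀ x t → x ^′ 2 * t + x * t * x ≡ ℤ.+ 2 * (x ^′ 2 * t)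
        double = solve-∀
      expandW : ∀ x s → ℤ.+ 2 * (x ^′ 2 * (x ^′ 2 + s - ℤ.+ 2 * x)) ≡ ℤ.+ 2 * x ^′ 4 + ℤ.+ 2 * (x ^′ 2 * s) - ℤ.+ 4 * x ^′ 3
      expandW = solve-∀
      vertexPart : Σ V (λ u → ℤ.+ 2 * (d u ^′ 2 * W u)) ≡ ℤ.+ 2 * ♯ M₁^ G 4 + ℤ.+ 2 * ♯ α G 1 - ℤ.+ 4 * ♯ F G
      vertexPart = Σ-via (λ {u} _ → expandW (d u) (S u)) (ℤ.+ 2 ⊛ ΣV-d^ 3 ⊕ ℤ.+ 2 ⊛ ΣV-d^S 1 ⊖ ℤ.+ 4 ⊛ ΣV-d^ 2) refl
      expandw : ∀ x y → x * ((x + y - ℤ.+ 2) + (x + y - ℤ.+ 2)) + y * ((x + y - ℤ.+ 2) + (x + y - ℤ.+ 2)) ≡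
                ℤ.+ 2 * (x ^′ 2 + y ^′ 2) + ℤ.+ 4 * (x * y) - ℤ.+ 4 * (x + y)
      expandw = solve-∀
      edgePart : Σ E (λ (u , v) → d u * (w u v + w u v) + d v * (w u v + w u v)) ≡ ℤ.+ 2 * ♯ F G + ℤ.+ 4 * ♯ M₂ G - ℤ.+ 4 * ♯ M₁ G
      edgePart = Σ-via (λ {e} _ → expandw (d (proj₁ e)) (d (proj₂ e))) (ℤ.+ 2 ⊛ Σ-d^ 1 ⊕ ℤ.+ 4 ⊛ Σ-dd ⊖ ℤ.+ 4 ⊛ Σ-d^ 0) refl
      collect : ∀ M4 F M1 al M2 →
        (ℤ.+ 2 * M4 + ℤ.+ 2 * al - ℤ.+ 4 * F) - (ℤ.+ 2 * F + ℤ.+ 4 * M2 - ℤ.+ 4 * M1) ≡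
        ℤ.+ 2 * al + ℤ.+ 2 * M4 - ℤ.+ 6 * F - ℤ.+ 4 * M2 + ℤ.+ 4 * M1
      collect = solve-∀

  -- Invariants of the deleted graph in terms of degrees near the edge.

  module EdgeDeletionInvariants {n : ℕ} (G : Graph n) (g : Girth≥5 G) (u v : Fin n) (uv : Graph._~_ G u v) where
    open Invariants G
    H′ = G -[ u , v ]

    N-Δ₁ : ∀ w → N (Δ 1) w ≡ - 1ℤ * d w
    N-Δ₁ w = Σ-via (λ {x} _ → arrange (a w x) (d x)) ((- 1ℤ) ⊛ sym (d≡Σa w)) refl
      where
      arrange : ∀ p x → p * ((x - 1ℤ) ^′ 1 - x ^′ 1) ≡ - 1ℤ * p
      arrange = solve-∀

    N-Δ₂ : ∀ w → N (Δ 2) w ≡ d w - ℤ.+ 2 * S w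
    N-Δ₂ w = Σ-via (λ {x} _ → arrange (a w x) (d x)) (sym (d≡Σa w) ⊖ ℤ.+ 2 ⊛ refl) refl
      where
      arrange : ∀ p x → p * ((x - 1ℤ) ^′ 2 - x ^′ 2) ≡ p - ℤ.+ 2 * (p * x)
      arrange = solve-∀

    N-Δ₃ : ∀ w → N (Δ 3) w ≡ ℤ.+ 3 * S w - d w - ℤ.+ 3 * N (λ x → d x ^′ 2) w
    N-Δ₃ w = Σ-via (λ {x} _ → arrange (a w x) (d x)) (ℤ.+ 3 ⊛ refl ⊖ sym (d≡Σa w) ⊖ ℤ.+ 3 ⊛ refl) refl
      where
      arrange : ∀ p x → p * ((x - 1ℤ) ^′ 3 - x ^′ 3) ≡ ℤ.+ 3 * (p * x) - p - ℤ.+ 3 * (p * x ^′ 2)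
      arrange = solve-∀

    N-Δ₄ : ∀ w → N (Δ 4) w ≡ d w - ℤ.+ 4 * S w + ℤ.+ 6 * N (λ x → d x ^′ 2) w - ℤ.+ 4 * N (λ x → d x ^′ 3) w
    N-Δ₄ w = Σ-via (λ {x} _ → arrange (a w x) (d x)) (sym (d≡Σa w) ⊖ ℤ.+ 4 ⊛ refl ⊕ ℤ.+ 6 ⊛ refl ⊖ ℤ.+ 4 ⊛ refl) refl
      where
      arrange : ∀ p x → p * ((x - 1ℤ) ^′ 4 - x ^′ 4) ≡ p - ℤ.+ 4 * (p * x) + ℤ.+ 6 * (p * x ^′ 2) - ℤ.+ 4 * (p * x ^′ 3)
      arrange = solve-∀

    M-H : ∀ k → ♯ M₁^ H′ (suc k) ≡ ♯ M₁^ G (suc k) + N (Δ (suc k)) u + N (Δ (suc k)) v - (d u - 1ℤ) ^′ suc k - (d v - 1ℤ) ^′ suc k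
    M-H k = trans (sym (Invariants.ΣV-d^ H′ k)) (trans (EdgeDeletionSums.power-sum G g u v uv k)
      (cong (λ z → z + N (Δ (suc k)) u + N (Δ (suc k)) v - (d u - 1ℤ) ^′ suc k - (d v - 1ℤ) ^′ suc k) (ΣV-d^ k)))

    -- The edge `(u , v)` is counted in both degrees, hence the added 1. It is derived from the
    -- degree sum, which is twice the size.
    size-H : Invariants.m H′ ≡ m + 1ℤ - (d u + d v)
    size-H = ℤ.*-cancelˡ-≡ (ℤ.+ 2) _ _ (begin
      ℤ.+ 2 * Invariants.m H′                           ≡⟨ Invariants.ΣV-d H′ ⟨
      -- `power-sum` is indexed by the predecessor of the exponent, and `x ^′ 1` computes to `x`.
      Σ V (Invariants.d H′)                             ≡⟨ EdgeDeletionSums.power-sum G g u v uv 0 ⟩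
      Σ V d + N (Δ 1) u + N (Δ 1) v - (d u - 1ℤ) - (d v - 1ℤ)
        ≡⟨ cong₂ (λ p q → p + q - (d u - 1ℤ) - (d v - 1ℤ)) (cong₂ _+_ ΣV-d (N-Δ₁ u)) (N-Δ₁ v) ⟩
      ℤ.+ 2 * m + - 1ℤ * d u + - 1ℤ * d v - (d u - 1ℤ) - (d v - 1ℤ) ≡⟨ collect m (d u) (d v) ⟩
      ℤ.+ 2 * (m + 1ℤ - (d u + d v))                    ∎)
      where
      open ≡-Reasoning
      collect : ∀ m x y → ℤ.+ 2 * m + - 1ℤ * x + - 1ℤ * y - (x - 1ℤ) - (y - 1ℤ) ≡ ℤ.+ 2 * (m + 1ℤ - (x + y))
      collect = solve-∀

    M₁-H : ♯ M₁ H′ ≡ ♯ M₁ G - ℤ.+ 2 + ℤ.+ 3 * (d u + d v) - (d u ^′ 2 + d v ^′ 2) - ℤ.+ 2 * (S u + S v)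
    M₁-H = trans (M-H 1) (trans (cong₂ (λ p q → ♯ M₁ G + p + q - (d u - 1ℤ) ^′ 2 - (d v - 1ℤ) ^′ 2) (N-Δ₂ u) (N-Δ₂ v))
                                (collect (♯ M₁ G) (d u) (d v) (S u) (S v)))
      where
      collect : ∀ M x y s t → M + (x - ℤ.+ 2 * s) + (y - ℤ.+ 2 * t) - (x - 1ℤ) ^′ 2 - (y - 1ℤ) ^′ 2 ≡
                M - ℤ.+ 2 + ℤ.+ 3 * (x + y) - (x ^′ 2 + y ^′ 2) - ℤ.+ 2 * (s + t)
      collect = solve-∀

    F-H : ♯ F H′ ≡ ♯ F G + ℤ.+ 2 - ℤ.+ 4 * (d u + d v) + ℤ.+ 3 * (d u ^′ 2 + d v ^′ 2) - (d u ^′ 3 + d v ^′ 3)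
          + ℤ.+ 3 * (S u + S v) - ℤ.+ 3 * (N (λ x → d x ^′ 2) u + N (λ x → d x ^′ 2) v)
    F-H = trans (M-H 2) (trans (cong₂ (λ p q → ♯ F G + p + q - (d u - 1ℤ) ^′ 3 - (d v - 1ℤ) ^′ 3) (N-Δ₃ u) (N-Δ₃ v))
                               (collect (♯ F G) (d u) (d v) (S u) (S v) (N (λ x → d x ^′ 2) u) (N (λ x → d x ^′ 2) v)))
      where
      collect : ∀ M x y s t p q → M + (ℤ.+ 3 * s - x - ℤ.+ 3 * p) + (ℤ.+ 3 * t - y - ℤ.+ 3 * q) - (x - 1ℤ) ^′ 3 - (y - 1ℤ) ^′ 3 ≡
                M + ℤ.+ 2 - ℤ.+ 4 * (x + y) + ℤ.+ 3 * (x ^′ 2 + y ^′ 2) - (x ^′ 3 + y ^′ 3) + ℤ.+ 3 * (s + t) - ℤ.+ 3 * (p + q)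
      collect = solve-∀

    M₁⁴-H : ♯ M₁^ H′ 4 ≡ ♯ M₁^ G 4 - ℤ.+ 2 + ℤ.+ 5 * (d u + d v) - ℤ.+ 6 * (d u ^′ 2 + d v ^′ 2) + ℤ.+ 4 * (d u ^′ 3 + d v ^′ 3)
            - (d u ^′ 4 + d v ^′ 4) - ℤ.+ 4 * (S u + S v) + ℤ.+ 6 * (N (λ x → d x ^′ 2) u + N (λ x → d x ^′ 2) v)
            - ℤ.+ 4 * (N (λ x → d x ^′ 3) u + N (λ x → d x ^′ 3) v)
    M₁⁴-H = trans (M-H 3) (trans (cong₂ (λ p q → ♯ M₁^ G 4 + p + q - (d u - 1ℤ) ^′ 4 - (d v - 1ℤ) ^′ 4) (N-Δ₄ u) (N-Δ₄ v))
                                 (collect (♯ M₁^ G 4) (d u) (d v) (S u) (S v) (N (λ x → d x ^′ 2) u) (N (λ x → d x ^′ 2) v)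
                                          (N (λ x → d x ^′ 3) u) (N (λ x → d x ^′ 3) v)))
      where
      collect : ∀ M x y s t p q r z →
        M + (x - ℤ.+ 4 * s + ℤ.+ 6 * p - ℤ.+ 4 * r) + (y - ℤ.+ 4 * t + ℤ.+ 6 * q - ℤ.+ 4 * z) - (x - 1ℤ) ^′ 4 - (y - 1ℤ) ^′ 4 ≡
        M - ℤ.+ 2 + ℤ.+ 5 * (x + y) - ℤ.+ 6 * (x ^′ 2 + y ^′ 2) + ℤ.+ 4 * (x ^′ 3 + y ^′ 3) - (x ^′ 4 + y ^′ 4)
          - ℤ.+ 4 * (s + t) + ℤ.+ 6 * (p + q) - ℤ.+ 4 * (r + z)
      collect = solve-∀

    M₂-H : ♯ M₂ H′ ≡ ♯ M₂ G - (d u * S u + d v * S v) + d u * d v - (N S u + N S v) + (d u ^′ 2 + d v ^′ 2)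
           + (S u + S v) - (d u + d v)
    M₂-H = ℤ.*-cancelˡ-≡ (ℤ.+ 2) _ _ (begin
      ℤ.+ 2 * ♯ M₂ H′                                  ≡⟨ Invariants.ΣV-dS H′ ⟨
      Σ V (λ x → Invariants.d H′ x * Invariants.S H′ x) ≡⟨ EdgeDeletionSums.edge-product-sum G g u v uv ⟩
      Σ V (λ x → d x * S x) - ℤ.+ 2 * (d u * S u + d v * S v) + ℤ.+ 2 * (d u * d v)
      - ℤ.+ 2 * (N S u + N S v - d u ^′ 2 - d v ^′ 2 - (S u + S v) + (d u + d v))
        ≡⟨ cong (λ z → z - ℤ.+ 2 * (d u * S u + d v * S v) + ℤ.+ 2 * (d u * d v)
                       - ℤ.+ 2 * (N S u + N S v - d u ^′ 2 - d v ^′ 2 - (S u + S v) + (d u + d v))) ΣV-dS ⟩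
      ℤ.+ 2 * ♯ M₂ G - ℤ.+ 2 * (d u * S u + d v * S v) + ℤ.+ 2 * (d u * d v)
      - ℤ.+ 2 * (N S u + N S v - d u ^′ 2 - d v ^′ 2 - (S u + S v) + (d u + d v))
        ≡⟨ collect (♯ M₂ G) (d u * S u + d v * S v) (d u) (d v) (S u + S v) (N S u) (N S v) ⟩
      ℤ.+ 2 * (♯ M₂ G - (d u * S u + d v * S v) + d u * d v - (N S u + N S v) + (d u ^′ 2 + d v ^′ 2) + (S u + S v) - (d u + d v)) ∎)
      where
      open ≡-Reasoning
      collect : ∀ M r x y s p q →
        ℤ.+ 2 * M - ℤ.+ 2 * r + ℤ.+ 2 * (x * y) - ℤ.+ 2 * (p + q - x ^′ 2 - y ^′ 2 - s + (x + y)) ≡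
        ℤ.+ 2 * (M - r + x * y - (p + q) + (x ^′ 2 + y ^′ 2) + s - (x + y))
      collect = solve-∀

  -- Averages of these invariants over all edges.

  module _ {n : ℕ} (G : Graph n) (g : Girth≥5 G) where
    open Invariants G

    -- Adjointness moves `N` from the squared degree onto `d`, and the pairing of `d u ^′ 2` with
    -- `S u` sums to `α`.
    Σ-N² : Σ E (λ (u , v) → N (λ x → d x ^′ 2) u + N (λ x → d x ^′ 2) v) ≡ ♯ α G 1
    Σ-N² = trans (Σ-edges-linear (N (λ x → d x ^′ 2))) (trans (N-adjoint d (λ x → d x ^′ 2)) (ΣV-d^S 1))

    Σ-N³ : Σ E (λ (u , v) → N (λ x → d x ^′ 3) u + N (λ x → d x ^′ 3) v) ≡ ♯ α G 2
    Σ-N³ = trans (Σ-edges-linear (N (λ x → d x ^′ 3))) (trans (N-adjoint d (λ x → d x ^′ 3)) (ΣV-d^S 2))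

    Σ-const : ∀ c → Σ E (λ _ → c) ≡ c * m
    Σ-const c = Σ-linear
      (c ⊡ ⟪ Σ-1 ⟫)
      (λ _ → sym (*-identityʳ c))

    Σ-size : Σ E (λ (u , v) → ♯ size (G -[ u , v ])) ≡ (m + 1ℤ) * m - ♯ M₁ G
    Σ-size = Σ-linear
      (⟪ Σ-const (m + 1ℤ) ⟫ ⊟ ⟪ Σ-d^ 0 ⟫)
      (λ e∈ → EdgeDeletionInvariants.size-H G g _ _ (proj₂ (∈E⇒ e∈)))

    Σ-size² : Σ E (λ (u , v) → (♯ size (G -[ u , v ])) ^′ 2) ≡ (m + 1ℤ) ^′ 2 * m - ℤ.+ 2 * (m + 1ℤ) * ♯ M₁ G + ♯ F G + ℤ.+ 2 * ♯ M₂ G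
    Σ-size² = Σ-linear
      (⟪ Σ-const ((m + 1ℤ) ^′ 2) ⟫ ⊟ (ℤ.+ 2 * (m + 1ℤ)) ⊡ ⟪ Σ-d^ 0 ⟫ ⊞ ⟪ Σ-d^ 1 ⟫ ⊞ ℤ.+ 2 ⊡ ⟪ Σ-dd ⟫)
      (λ {e} e∈ → trans (cong (_^′ 2) (EdgeDeletionInvariants.size-H G g _ _ (proj₂ (∈E⇒ e∈)))) (expand m (d (proj₁ e)) (d (proj₂ e))))
      where
      expand : ∀ m x y → (m + 1ℤ - (x + y)) ^′ 2 ≡ (m + 1ℤ) ^′ 2 - ℤ.+ 2 * (m + 1ℤ) * (x + y) + (x ^′ 2 + y ^′ 2) + ℤ.+ 2 * (x * y)
      expand = solve-∀

    Σ-size³ : Σ E (λ (u , v) → (♯ size (G -[ u , v ])) ^′ 3) ≡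
      (m + 1ℤ) ^′ 3 * m - ℤ.+ 3 * (m + 1ℤ) ^′ 2 * ♯ M₁ G + ℤ.+ 3 * (m + 1ℤ) * ♯ F G + ℤ.+ 6 * (m + 1ℤ) * ♯ M₂ G
      - ♯ M₁^ G 4 - ℤ.+ 3 * ♯ α G 1
    Σ-size³ = Σ-linear
      (⟪ Σ-const ((m + 1ℤ) ^′ 3) ⟫ ⊟ (ℤ.+ 3 * (m + 1ℤ) ^′ 2) ⊡ ⟪ Σ-d^ 0 ⟫
        ⊞ (ℤ.+ 3 * (m + 1ℤ)) ⊡ ⟪ Σ-d^ 1 ⟫ ⊞ (ℤ.+ 6 * (m + 1ℤ)) ⊡ ⟪ Σ-dd ⟫ ⊟ ⟪ Σ-d^ 2 ⟫ ⊟ ℤ.+ 3 ⊡ ⟪ Σ-α 1 ⟫)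
      (λ {e} e∈ → trans (cong (_^′ 3) (EdgeDeletionInvariants.size-H G g _ _ (proj₂ (∈E⇒ e∈)))) (expand m (d (proj₁ e)) (d (proj₂ e))))
      where
      expand : ∀ m x y → (m + 1ℤ - (x + y)) ^′ 3 ≡
        (m + 1ℤ) ^′ 3 - ℤ.+ 3 * (m + 1ℤ) ^′ 2 * (x + y) + ℤ.+ 3 * (m + 1ℤ) * (x ^′ 2 + y ^′ 2) + ℤ.+ 6 * (m + 1ℤ) * (x * y)
        - (x ^′ 3 + y ^′ 3) - ℤ.+ 3 * (x * y * (x + y))
      expand = solve-∀

    Σ-size⁴ : Σ E (λ (u , v) → (♯ size (G -[ u , v ])) ^′ 4) ≡
      (m + 1ℤ) ^′ 4 * m - ℤ.+ 4 * (m + 1ℤ) ^′ 3 * ♯ M₁ G + ℤ.+ 6 * (m + 1ℤ) ^′ 2 * ♯ F G + ℤ.+ 12 * (m + 1ℤ) ^′ 2 * ♯ M₂ G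
      - ℤ.+ 4 * (m + 1ℤ) * ♯ M₁^ G 4 - ℤ.+ 12 * (m + 1ℤ) * ♯ α G 1 + ♯ M₁^ G 5 + ℤ.+ 4 * ♯ α G 2 + ℤ.+ 6 * ♯ M₂^ G 2
    Σ-size⁴ = Σ-linear
      (⟪ Σ-const ((m + 1ℤ) ^′ 4) ⟫ ⊟ (ℤ.+ 4 * (m + 1ℤ) ^′ 3) ⊡ ⟪ Σ-d^ 0 ⟫
        ⊞ (ℤ.+ 6 * (m + 1ℤ) ^′ 2) ⊡ ⟪ Σ-d^ 1 ⟫ ⊞ (ℤ.+ 12 * (m + 1ℤ) ^′ 2) ⊡ ⟪ Σ-dd ⟫
        ⊟ (ℤ.+ 4 * (m + 1ℤ)) ⊡ ⟪ Σ-d^ 2 ⟫ ⊟ (ℤ.+ 12 * (m + 1ℤ)) ⊡ ⟪ Σ-α 1 ⟫ ⊞ ⟪ Σ-d^ 3 ⟫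
        ⊞ ℤ.+ 4 ⊡ ⟪ Σ-α 2 ⟫ ⊞ ℤ.+ 6 ⊡ ⟪ Σ-d²d² ⟫)
      (λ {e} e∈ → trans (cong (_^′ 4) (EdgeDeletionInvariants.size-H G g _ _ (proj₂ (∈E⇒ e∈)))) (expand m (d (proj₁ e)) (d (proj₂ e))))
      where
      expand : ∀ m x y → (m + 1ℤ - (x + y)) ^′ 4 ≡
        (m + 1ℤ) ^′ 4 - ℤ.+ 4 * (m + 1ℤ) ^′ 3 * (x + y) + ℤ.+ 6 * (m + 1ℤ) ^′ 2 * (x ^′ 2 + y ^′ 2) + ℤ.+ 12 * (m + 1ℤ) ^′ 2 * (x * y)
        - ℤ.+ 4 * (m + 1ℤ) * (x ^′ 3 + y ^′ 3) - ℤ.+ 12 * (m + 1ℤ) * (x * y * (x + y))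
        + (x ^′ 4 + y ^′ 4) + ℤ.+ 4 * (x * y * (x ^′ 2 + y ^′ 2)) + ℤ.+ 6 * (x ^′ 2 * y ^′ 2)
      expand = solve-∀

    Σ-M₁ : Σ E (λ (u , v) → ♯ M₁ (G -[ u , v ])) ≡ (♯ M₁ G - ℤ.+ 2) * m + ℤ.+ 3 * ♯ M₁ G - ♯ F G - ℤ.+ 2 * (ℤ.+ 2 * ♯ M₂ G)
    Σ-M₁ = Σ-linear
      (⟪ Σ-const (♯ M₁ G - ℤ.+ 2) ⟫ ⊞ ℤ.+ 3 ⊡ ⟪ Σ-d^ 0 ⟫ ⊟ ⟪ Σ-d^ 1 ⟫ ⊟ ℤ.+ 2 ⊡ ⟪ Σ-S ⟫)
      (λ e∈ → EdgeDeletionInvariants.M₁-H G g _ _ (proj₂ (∈E⇒ e∈)))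

    Σ-F : Σ E (λ (u , v) → ♯ F (G -[ u , v ])) ≡
      (♯ F G + ℤ.+ 2) * m - ℤ.+ 4 * ♯ M₁ G + ℤ.+ 3 * ♯ F G - ♯ M₁^ G 4 + ℤ.+ 3 * (ℤ.+ 2 * ♯ M₂ G) - ℤ.+ 3 * ♯ α G 1
    Σ-F = Σ-linear
      (⟪ Σ-const (♯ F G + ℤ.+ 2) ⟫ ⊟ ℤ.+ 4 ⊡ ⟪ Σ-d^ 0 ⟫ ⊞ ℤ.+ 3 ⊡ ⟪ Σ-d^ 1 ⟫ ⊟ ⟪ Σ-d^ 2 ⟫ ⊞ ℤ.+ 3 ⊡ ⟪ Σ-S ⟫
        ⊟ ℤ.+ 3 ⊡ ⟪ Σ-N² ⟫)
      (λ e∈ → EdgeDeletionInvariants.F-H G g _ _ (proj₂ (∈E⇒ e∈)))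

    Σ-M₁⁴ : Σ E (λ (u , v) → ♯ M₁^ (G -[ u , v ]) 4) ≡
      (♯ M₁^ G 4 - ℤ.+ 2) * m + ℤ.+ 5 * ♯ M₁ G - ℤ.+ 6 * ♯ F G + ℤ.+ 4 * ♯ M₁^ G 4 - ♯ M₁^ G 5
      - ℤ.+ 4 * (ℤ.+ 2 * ♯ M₂ G) + ℤ.+ 6 * ♯ α G 1 - ℤ.+ 4 * ♯ α G 2
    Σ-M₁⁴ = Σ-linear
      (⟪ Σ-const (♯ M₁^ G 4 - ℤ.+ 2) ⟫ ⊞ ℤ.+ 5 ⊡ ⟪ Σ-d^ 0 ⟫ ⊟ ℤ.+ 6 ⊡ ⟪ Σ-d^ 1 ⟫ ⊞ ℤ.+ 4 ⊡ ⟪ Σ-d^ 2 ⟫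
        ⊟ ⟪ Σ-d^ 3 ⟫ ⊟ ℤ.+ 4 ⊡ ⟪ Σ-S ⟫ ⊞ ℤ.+ 6 ⊡ ⟪ Σ-N² ⟫ ⊟ ℤ.+ 4 ⊡ ⟪ Σ-N³ ⟫)
      (λ e∈ → EdgeDeletionInvariants.M₁⁴-H G g _ _ (proj₂ (∈E⇒ e∈)))

    Σ-M₂ : Σ E (λ (u , v) → ♯ M₂ (G -[ u , v ])) ≡
      ♯ M₂ G * m - ♯ α G 1 + ♯ M₂ G - T + ♯ F G + ℤ.+ 2 * ♯ M₂ G - ♯ M₁ G
    Σ-M₂ = Σ-linear
      (⟪ Σ-const (♯ M₂ G) ⟫ ⊟ ⟪ Σ-dS ⟫ ⊞ ⟪ Σ-dd ⟫ ⊟ ⟪ Σ-NS ⟫ ⊞ ⟪ Σ-d^ 1 ⟫ ⊞ ⟪ Σ-S ⟫ ⊟ ⟪ Σ-d^ 0 ⟫)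
      (λ e∈ → EdgeDeletionInvariants.M₂-H G g _ _ (proj₂ (∈E⇒ e∈)))

    -- Degrees at one end meet neighbour sums at the other; these mixed terms contribute `T`, just
    -- as `N S` does in `Σ-M₂`.
    Σ-sizeM₁ : Σ E (λ (u , v) → ♯ size (G -[ u , v ]) * ♯ M₁ (G -[ u , v ])) ≡
      (m + 1ℤ) * (♯ M₁ G - ℤ.+ 2) * m + (ℤ.+ 3 * (m + 1ℤ) - (♯ M₁ G - ℤ.+ 2)) * ♯ M₁ G - (m + ℤ.+ 4) * ♯ F G
      - ℤ.+ 2 * (m + 1ℤ) * (ℤ.+ 2 * ♯ M₂ G) - ℤ.+ 6 * ♯ M₂ G + ♯ M₁^ G 4 + ♯ α G 1 + ℤ.+ 2 * ♯ α G 1 + ℤ.+ 2 * T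
    Σ-sizeM₁ = Σ-linear
      (⟪ Σ-const ((m + 1ℤ) * (♯ M₁ G - ℤ.+ 2)) ⟫ ⊞ (ℤ.+ 3 * (m + 1ℤ) - (♯ M₁ G - ℤ.+ 2)) ⊡ ⟪ Σ-d^ 0 ⟫
        ⊟ (m + ℤ.+ 4) ⊡ ⟪ Σ-d^ 1 ⟫ ⊟ (ℤ.+ 2 * (m + 1ℤ)) ⊡ ⟪ Σ-S ⟫ ⊟ ℤ.+ 6 ⊡ ⟪ Σ-dd ⟫ ⊞ ⟪ Σ-d^ 2 ⟫
        ⊞ ⟪ Σ-α 1 ⟫ ⊞ ℤ.+ 2 ⊡ ⟪ Σ-dS ⟫ ⊞ ℤ.+ 2 ⊡ ⟪ Σ-dS-cross ⟫)
      (λ {e} e∈ → trans (cong₂ _*_ (EdgeDeletionInvariants.size-H G g _ _ (proj₂ (∈E⇒ e∈))) (EdgeDeletionInvariants.M₁-H G g _ _ (proj₂ (∈E⇒ e∈))))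
       (expand m (♯ M₁ G) (d (proj₁ e)) (d (proj₂ e)) (S (proj₁ e)) (S (proj₂ e))))
      where
      expand : ∀ m M x y s t →
        (m + 1ℤ - (x + y)) * (M - ℤ.+ 2 + ℤ.+ 3 * (x + y) - (x ^′ 2 + y ^′ 2) - ℤ.+ 2 * (s + t)) ≡
        (m + 1ℤ) * (M - ℤ.+ 2) + (ℤ.+ 3 * (m + 1ℤ) - (M - ℤ.+ 2)) * (x + y) - (m + ℤ.+ 4) * (x ^′ 2 + y ^′ 2)
        - ℤ.+ 2 * (m + 1ℤ) * (s + t) - ℤ.+ 6 * (x * y) + (x ^′ 3 + y ^′ 3) + x * y * (x + y)
        + ℤ.+ 2 * (x * s + y * t) + ℤ.+ 2 * (x * t + s * y)
      expand = solve-∀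

  -- Formulas for the numbers of matchings with one to five edges.

  module _ {n : ℕ} where

    Disjoint-sym : ∀ {e f : Edge n} → Disjoint e f → Disjoint f e
    Disjoint-sym dis (inj₁ (inj₁ eq)) = dis (inj₁ (inj₁ (sym eq)))
    Disjoint-sym dis (inj₁ (inj₂ eq)) = dis (inj₂ (inj₁ (sym eq)))
    Disjoint-sym dis (inj₂ (inj₁ eq)) = dis (inj₁ (inj₂ (sym eq)))
    Disjoint-sym dis (inj₂ (inj₂ eq)) = dis (inj₂ (inj₂ (sym eq)))

    Disjoint-irrefl : ∀ {e : Edge n} → ¬ Disjoint e e
    Disjoint-irrefl dis = dis (inj₁ (inj₁ refl))

    open PairwiseSublists (disjoint? {n}) Disjoint-sym Disjoint-irrefl

    p-recurrence : ∀ (G : Graph n) k → ℤ.+ suc k * ♯ p G (suc k) ≡ Σ (edges G) (λ (u , v) → ♯ p (G -[ u , v ]) k)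
    p-recurrence G k = begin
      ℤ.+ suc k * ♯ p G (suc k)                                     ≡⟨ cong (ℤ.+ suc k *_) (♯-length-filter-allPairs (suc k) (edges G)) ⟩
      ℤ.+ suc k * count (suc k) (edges G)                           ≡⟨ count-* k (edges G) ⟩
      Σ (edges G) (λ e → count k (filter (disjoint? e) (edges G))) ≡⟨ Σ-cong (edges G) (λ (u , v) → cong (count k) (EdgeDeletion.edges-H G u v)) ⟨
      Σ (edges G) (λ (u , v) → count k (edges (G -[ u , v ])))    ≡⟨ Σ-cong (edges G) (λ (u , v) → ♯-length-filter-allPairs k (edges (G -[ u , v ]))) ⟨
      Σ (edges G) (λ (u , v) → ♯ p (G -[ u , v ]) k)              ∎
      where open ≡-Reasoning

    -- The factor `c` will be `k!`, which clears the denominators of the formula for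
    -- `p (G -[ u , v ]) k` and keeps everything integral.
    scaled-recurrence : ∀ (G : Graph n) k c (s : Summed (edges G)) →
      (∀ {u v} → (u , v) ∈ edges G → c * ♯ p (G -[ u , v ]) k ≡ summand s (u , v)) → c * (ℤ.+ suc k * ♯ p G (suc k)) ≡ total s
    scaled-recurrence G k c s eq = trans (cong (c *_) (p-recurrence G k)) (trans (sym (c ⊛ refl)) (Σ-linear s eq))

    p₁ : ∀ (G : Graph n) → ♯ p G 1 ≡ ♯ size G
    -- The empty matching is the only one with no edges: `p (G -[ u , v ]) 0` computes to 1.
    p₁ G = trans (sym (*-identityˡ (♯ p G 1))) (trans (p-recurrence G 0) (trans (Σ-cong (edges G) λ _ → ♯≡+ 1) (sym (♯-length (edges G)))))

    p₂ : ∀ (G : Graph n) → Girth≥5 G → ℤ.+ 2 * ♯ p G 2 ≡ (♯ size G) ^′ 2 + ♯ size G - ♯ M₁ G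
    p₂ G g = begin
      ℤ.+ 2 * ♯ p G 2                                      ≡⟨ p-recurrence G 1 ⟩
      Σ (edges G) (λ (u , v) → ♯ p (G -[ u , v ]) 1)     ≡⟨ Σ-cong (edges G) (λ (u , v) → p₁ (G -[ u , v ])) ⟩
      Σ (edges G) (λ (u , v) → ♯ size (G -[ u , v ]))    ≡⟨ Σ-size G g ⟩
      (♯ size G + 1ℤ) * ♯ size G - ♯ M₁ G                ≡⟨ collect (♯ size G) (♯ M₁ G) ⟩
      (♯ size G) ^′ 2 + ♯ size G - ♯ M₁ G                 ∎
      where
      open ≡-Reasoning
      collect : ∀ m M → (m + 1ℤ) * m - M ≡ m ^′ 2 + m - M
      collect = solve-∀

    p₃ : ∀ (G : Graph n) → Girth≥5 G → ℤ.+ 6 * ♯ p G 3 ≡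
      (♯ size G) ^′ 3 + ℤ.+ 3 * (♯ size G) ^′ 2 + ℤ.+ 4 * ♯ size G - ℤ.+ 3 * (♯ size G * ♯ M₁ G) - ℤ.+ 6 * ♯ M₁ G + ℤ.+ 2 * ♯ F G + ℤ.+ 6 * ♯ M₂ G
    p₃ G g = trans (assoc (♯ p G 3)) (trans
      (scaled-recurrence G 2 (ℤ.+ 2)
        (⟪ Σ-size² G g ⟫ ⊞ ⟪ Σ-size G g ⟫ ⊟ ⟪ Σ-M₁ G g ⟫)
        (λ {u} {v} _ → p₂ (G -[ u , v ]) (EdgeDeletion.girth≥5 G u v g)))
      (collect (♯ size G) (♯ M₁ G) (♯ F G) (♯ M₂ G)))
      where
      assoc : ∀ x → ℤ.+ 6 * x ≡ ℤ.+ 2 * (ℤ.+ 3 * x)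
      assoc = solve-∀
      collect : ∀ m M F M₂ →
        ((m + 1ℤ) ^′ 2 * m - ℤ.+ 2 * (m + 1ℤ) * M + F + ℤ.+ 2 * M₂) + ((m + 1ℤ) * m - M) - ((M - ℤ.+ 2) * m + ℤ.+ 3 * M - F - ℤ.+ 2 * (ℤ.+ 2 * M₂)) ≡
        m ^′ 3 + ℤ.+ 3 * m ^′ 2 + ℤ.+ 4 * m - ℤ.+ 3 * (m * M) - ℤ.+ 6 * M + ℤ.+ 2 * F + ℤ.+ 6 * M₂
      collect = solve-∀

    -- Eliminates an invariant x = y from a polynomial z by a multiple of y - x, so that a ring
    -- identity without hypotheses remains.
    add-zero : ∀ {x y z c} → x ≡ y → z ≡ z + c * (y - x)
    add-zero {x} {z = z} {c} refl = lemma x z c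
      where
      lemma : ∀ x z c → z ≡ z + c * (x - x)
      lemma = solve-∀

    p₄ : ∀ (G : Graph n) → Girth≥5 G → ℤ.+ 24 * ♯ p G 4 ≡
      (♯ size G) ^′ 4 + ℤ.+ 6 * (♯ size G) ^′ 3 + ℤ.+ 19 * (♯ size G) ^′ 2 - ℤ.+ 66 * ♯ size G
      + ℤ.+ 3 * (♯ M₁ G) ^′ 2 - ℤ.+ 6 * ((♯ size G) ^′ 2 * ♯ M₁ G) - ℤ.+ 30 * (♯ size G * ♯ M₁ G) + ℤ.+ 84 * ♯ M₁ G
      + ℤ.+ 8 * (♯ size G * ♯ F G) - ℤ.+ 36 * ♯ F G + ℤ.+ 24 * (♯ size G * ♯ M₂ G) - ℤ.+ 48 * ♯ M₂ G + ℤ.+ 6 * ♯ M₁^ G 4 - ℤ.+ 24 * ♯ EM₂ G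
    p₄ G g = trans (assoc (♯ p G 4)) (trans
      (scaled-recurrence G 3 (ℤ.+ 6)
        (⟪ Σ-size³ G g ⟫ ⊞ ℤ.+ 3 ⊡ ⟪ Σ-size² G g ⟫ ⊞ ℤ.+ 4 ⊡ ⟪ Σ-size G g ⟫ ⊟ ℤ.+ 3 ⊡ ⟪ Σ-sizeM₁ G g ⟫ ⊟ ℤ.+ 6 ⊡ ⟪ Σ-M₁ G g ⟫
          ⊞ ℤ.+ 2 ⊡ ⟪ Σ-F G g ⟫ ⊞ ℤ.+ 6 ⊡ ⟪ Σ-M₂ G g ⟫)
        (λ {u} {v} _ → p₃ (G -[ u , v ]) (EdgeDeletion.girth≥5 G u v g)))
      -- `T` has coefficient -6 from `Σ-sizeM₁` and -6 from `Σ-M₂`; 12 copies of the identity for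
      -- `EM₂` cancel it and leave -24 `EM₂`.
      (trans (add-zero {c = ℤ.+ 12} (MeetingPairs.2*EM₂ G))
             (collect (♯ size G) (♯ M₁ G) (♯ F G) (♯ M₂ G) (♯ M₁^ G 4) (♯ α G 1) (Invariants.T G) (♯ EM₂ G))))
      where
      assoc : ∀ x → ℤ.+ 24 * x ≡ ℤ.+ 6 * (ℤ.+ 4 * x)
      assoc = solve-∀
      collect : ∀ m M F M₂ M₄ α T EM →
        ((m + 1ℤ) ^′ 3 * m - ℤ.+ 3 * (m + 1ℤ) ^′ 2 * M + ℤ.+ 3 * (m + 1ℤ) * F + ℤ.+ 6 * (m + 1ℤ) * M₂ - M₄ - ℤ.+ 3 * α)
        + ℤ.+ 3 * ((m + 1ℤ) ^′ 2 * m - ℤ.+ 2 * (m + 1ℤ) * M + F + ℤ.+ 2 * M₂)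
        + ℤ.+ 4 * ((m + 1ℤ) * m - M)
        - ℤ.+ 3 * ((m + 1ℤ) * (M - ℤ.+ 2) * m + (ℤ.+ 3 * (m + 1ℤ) - (M - ℤ.+ 2)) * M - (m + ℤ.+ 4) * F
                 - ℤ.+ 2 * (m + 1ℤ) * (ℤ.+ 2 * M₂) - ℤ.+ 6 * M₂ + M₄ + α + ℤ.+ 2 * α + ℤ.+ 2 * T)
        - ℤ.+ 6 * ((M - ℤ.+ 2) * m + ℤ.+ 3 * M - F - ℤ.+ 2 * (ℤ.+ 2 * M₂))
        + ℤ.+ 2 * ((F + ℤ.+ 2) * m - ℤ.+ 4 * M + ℤ.+ 3 * F - M₄ + ℤ.+ 3 * (ℤ.+ 2 * M₂) - ℤ.+ 3 * α)
        + ℤ.+ 6 * (M₂ * m - α + M₂ - T + F + ℤ.+ 2 * M₂ - M)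
        + ℤ.+ 12 * ((T + ℤ.+ 2 * α - ℤ.+ 12 * M₂ + M₄ - ℤ.+ 6 * F + ℤ.+ 12 * M - ℤ.+ 8 * m) - ℤ.+ 2 * EM) ≡
        m ^′ 4 + ℤ.+ 6 * m ^′ 3 + ℤ.+ 19 * m ^′ 2 - ℤ.+ 66 * m
        + ℤ.+ 3 * M ^′ 2 - ℤ.+ 6 * (m ^′ 2 * M) - ℤ.+ 30 * (m * M) + ℤ.+ 84 * M
        + ℤ.+ 8 * (m * F) - ℤ.+ 36 * F + ℤ.+ 24 * (m * M₂) - ℤ.+ 48 * M₂ + ℤ.+ 6 * M₄ - ℤ.+ 24 * EM
      collect = solve-∀

    -- The five sums enter as variables `s₁` to `s₅`, being left unevaluated. Their coefficients 3,
    -- 8, -6, -24, 24 are those of the corresponding terms in `p₄`; division by 24 gives 1/8, 1/3,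
    -- -1/4, -1, 1. The factor 120 is that 24 times the 5 of the recurrence.
    p₅ : ∀ (G : Graph n) → Girth≥5 G → let m = ♯ size G; M = ♯ M₁ G in ∀ {s₁ s₂ s₃ s₄ s₅} →
      Σ (edges G) (λ (u , v) → (♯ M₁ (G -[ u , v ])) ^′ 2) ≡ s₁ →
      Σ (edges G) (λ (u , v) → ♯ size (G -[ u , v ]) * ♯ F (G -[ u , v ])) ≡ s₂ →
      Σ (edges G) (λ (u , v) → (♯ size (G -[ u , v ])) ^′ 2 * ♯ M₁ (G -[ u , v ])) ≡ s₃ →
      Σ (edges G) (λ (u , v) → ♯ EM₂ (G -[ u , v ])) ≡ s₄ →
      Σ (edges G) (λ (u , v) → ♯ size (G -[ u , v ]) * ♯ M₂ (G -[ u , v ])) ≡ s₅ →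
      ℤ.+ 120 * ♯ p G 5 ≡
        m * (m ^′ 4 + ℤ.+ 10 * m ^′ 3 + ℤ.+ 43 * m ^′ 2 + ℤ.+ 54 * m - ℤ.+ 328) + ℤ.+ 30 * M ^′ 2
        - ℤ.+ 12 * (♯ α G 1 * (m - ℤ.+ 7)) - ℤ.+ 20 * ♯ α G 2
        - ℤ.+ 2 * (M * (ℤ.+ 2 * m ^′ 3 + ℤ.+ 30 * m ^′ 2 + ℤ.+ 61 * m - ℤ.+ 225)) + ℤ.+ 12 * ♯ β G
        + ℤ.+ 2 * (♯ M₂ G * (ℤ.+ 6 * m ^′ 2 + ℤ.+ 66 * m - ℤ.+ 239)) + ♯ F G * (ℤ.+ 6 * m ^′ 2 + ℤ.+ 24 * m - ℤ.+ 149)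
        + ℤ.+ 2 * (♯ M₁^ G 4 * (m + ℤ.+ 10)) + ℤ.+ 6 * ♯ M₂^ G 2 - ℤ.+ 24 * ♯ EM₂ G - ℤ.+ 5 * ♯ M₁^ G 5
        + ℤ.+ 3 * s₁ + ℤ.+ 8 * s₂ - ℤ.+ 6 * s₃ - ℤ.+ 24 * s₄ + ℤ.+ 24 * s₅
    p₅ G g {s₁} {s₂} {s₃} {s₄} {s₅} eq₁ eq₂ eq₃ eq₄ eq₅ = trans (assoc (♯ p G 5)) (trans
      (scaled-recurrence G 4 (ℤ.+ 24)
        (⟪ Σ-size⁴ G g ⟫ ⊞ ℤ.+ 6 ⊡ ⟪ Σ-size³ G g ⟫ ⊞ ℤ.+ 19 ⊡ ⟪ Σ-size² G g ⟫ ⊟ ℤ.+ 66 ⊡ ⟪ Σ-size G g ⟫ ⊞ ℤ.+ 3 ⊡ ⟪ eq₁ ⟫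
          ⊟ ℤ.+ 6 ⊡ ⟪ eq₃ ⟫ ⊟ ℤ.+ 30 ⊡ ⟪ Σ-sizeM₁ G g ⟫ ⊞ ℤ.+ 84 ⊡ ⟪ Σ-M₁ G g ⟫ ⊞ ℤ.+ 8 ⊡ ⟪ eq₂ ⟫ ⊟ ℤ.+ 36 ⊡ ⟪ Σ-F G g ⟫
          ⊞ ℤ.+ 24 ⊡ ⟪ eq₅ ⟫ ⊟ ℤ.+ 48 ⊡ ⟪ Σ-M₂ G g ⟫ ⊞ ℤ.+ 6 ⊡ ⟪ Σ-M₁⁴ G g ⟫ ⊟ ℤ.+ 24 ⊡ ⟪ eq₄ ⟫)
        (λ {u} {v} _ → p₄ (G -[ u , v ]) (EdgeDeletion.girth≥5 G u v g)))
      -- Here `T` has coefficient -60 + 48 = -12, from `Σ-sizeM₁` and `Σ-M₂`, so the multiplier is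
      -- 12 once more. The multiplier -6 cancels nothing: it produces the term 12 `β`, which is 120
      -- times 1/5 times the prescribed 1/2.
      (trans (add-zero {c = ℤ.+ 12} (MeetingPairs.2*EM₂ G)) (trans (add-zero {c = - ℤ.+ 6} (MeetingPairs.2*β G))
             (collect (♯ size G) (♯ M₁ G) (♯ F G) (♯ M₂ G) (♯ M₁^ G 4) (♯ α G 1) (Invariants.T G) (♯ EM₂ G)
                      (♯ M₁^ G 5) (♯ α G 2) (♯ M₂^ G 2) (♯ β G) s₁ s₂ s₃ s₄ s₅))))
      where
      assoc : ∀ x → ℤ.+ 120 * x ≡ ℤ.+ 24 * (ℤ.+ 5 * x)
      assoc = solve-∀
      collect : ∀ m M F M₂ M₄ α T EM M₅ α₂ M₂₂ β s₁ s₂ s₃ s₄ s₅ →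
        ((m + 1ℤ) ^′ 4 * m - ℤ.+ 4 * (m + 1ℤ) ^′ 3 * M + ℤ.+ 6 * (m + 1ℤ) ^′ 2 * F + ℤ.+ 12 * (m + 1ℤ) ^′ 2 * M₂
         - ℤ.+ 4 * (m + 1ℤ) * M₄ - ℤ.+ 12 * (m + 1ℤ) * α + M₅ + ℤ.+ 4 * α₂ + ℤ.+ 6 * M₂₂)
        + ℤ.+ 6 * ((m + 1ℤ) ^′ 3 * m - ℤ.+ 3 * (m + 1ℤ) ^′ 2 * M + ℤ.+ 3 * (m + 1ℤ) * F + ℤ.+ 6 * (m + 1ℤ) * M₂ - M₄ - ℤ.+ 3 * α)
        + ℤ.+ 19 * ((m + 1ℤ) ^′ 2 * m - ℤ.+ 2 * (m + 1ℤ) * M + F + ℤ.+ 2 * M₂)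
        - ℤ.+ 66 * ((m + 1ℤ) * m - M)
        + ℤ.+ 3 * s₁ - ℤ.+ 6 * s₃
        - ℤ.+ 30 * ((m + 1ℤ) * (M - ℤ.+ 2) * m + (ℤ.+ 3 * (m + 1ℤ) - (M - ℤ.+ 2)) * M - (m + ℤ.+ 4) * F
                 - ℤ.+ 2 * (m + 1ℤ) * (ℤ.+ 2 * M₂) - ℤ.+ 6 * M₂ + M₄ + α + ℤ.+ 2 * α + ℤ.+ 2 * T)
        + ℤ.+ 84 * ((M - ℤ.+ 2) * m + ℤ.+ 3 * M - F - ℤ.+ 2 * (ℤ.+ 2 * M₂))
        + ℤ.+ 8 * s₂
        - ℤ.+ 36 * ((F + ℤ.+ 2) * m - ℤ.+ 4 * M + ℤ.+ 3 * F - M₄ + ℤ.+ 3 * (ℤ.+ 2 * M₂) - ℤ.+ 3 * α)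
        + ℤ.+ 24 * s₅
        - ℤ.+ 48 * (M₂ * m - α + M₂ - T + F + ℤ.+ 2 * M₂ - M)
        + ℤ.+ 6 * ((M₄ - ℤ.+ 2) * m + ℤ.+ 5 * M - ℤ.+ 6 * F + ℤ.+ 4 * M₄ - M₅ - ℤ.+ 4 * (ℤ.+ 2 * M₂) + ℤ.+ 6 * α - ℤ.+ 4 * α₂)
        - ℤ.+ 24 * s₄
        + ℤ.+ 12 * ((T + ℤ.+ 2 * α - ℤ.+ 12 * M₂ + M₄ - ℤ.+ 6 * F + ℤ.+ 12 * M - ℤ.+ 8 * m) - ℤ.+ 2 * EM)
        + - ℤ.+ 6 * ((ℤ.+ 2 * α + ℤ.+ 2 * M₄ - ℤ.+ 6 * F - ℤ.+ 4 * M₂ + ℤ.+ 4 * M) - ℤ.+ 2 * β) ≡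
        m * (m ^′ 4 + ℤ.+ 10 * m ^′ 3 + ℤ.+ 43 * m ^′ 2 + ℤ.+ 54 * m - ℤ.+ 328) + ℤ.+ 30 * M ^′ 2
        - ℤ.+ 12 * (α * (m - ℤ.+ 7)) - ℤ.+ 20 * α₂
        - ℤ.+ 2 * (M * (ℤ.+ 2 * m ^′ 3 + ℤ.+ 30 * m ^′ 2 + ℤ.+ 61 * m - ℤ.+ 225)) + ℤ.+ 12 * β
        + ℤ.+ 2 * (M₂ * (ℤ.+ 6 * m ^′ 2 + ℤ.+ 66 * m - ℤ.+ 239)) + F * (ℤ.+ 6 * m ^′ 2 + ℤ.+ 24 * m - ℤ.+ 149)
        + ℤ.+ 2 * (M₄ * (m + ℤ.+ 10)) + ℤ.+ 6 * M₂₂ - ℤ.+ 24 * EM - ℤ.+ 5 * M₅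
        + ℤ.+ 3 * s₁ + ℤ.+ 8 * s₂ - ℤ.+ 6 * s₃ - ℤ.+ 24 * s₄ + ℤ.+ 24 * s₅
      collect = solve-∀

  -- From the girth to the absence of triangles and quadrilaterals.

  module _ {n : ℕ} (G : Graph n) where
    open Graph G

    ~⇒≢ : ∀ {x y} → x ~ y → x ≢ y
    ~⇒≢ xy refl = ~-irrefl xy

    triangle : ∀ {x y z} → x ~ y → y ~ z → z ~ x → Cycle G 3
    triangle {x} {y} {z} xy yz zx = record
      { vertex      = x ∷ᶠ y ∷ᶠ z ∷ᶠ []ᶠ
      ; 3≤ℓ         = ℕ.≤-refl
      ; injective   = λ
        { {0F} {0F} _  → refl
        ; {0F} {1F} eq → contradiction eq (~⇒≢ xy)
        ; {0F} {2F} eq → contradiction (sym eq) (~⇒≢ zx)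
        ; {1F} {0F} eq → contradiction (sym eq) (~⇒≢ xy)
        ; {1F} {1F} _  → refl
        ; {1F} {2F} eq → contradiction eq (~⇒≢ yz)
        ; {2F} {0F} eq → contradiction eq (~⇒≢ zx)
        ; {2F} {1F} eq → contradiction (sym eq) (~⇒≢ yz)
        ; {2F} {2F} _  → refl
        }
      ; consecutive = λ { 0F 1F _ → xy ; 1F 2F _ → yz ; 0F 0F () ; 0F 2F () ; 1F 0F () ; 1F 1F () ; 2F 0F () ; 2F 1F () ; 2F 2F () }
      ; closing     = λ { 2F 0F _ _ → zx ; 0F _ () _ ; 1F _ () _ ; 2F 1F _ () ; 2F 2F _ () }
      }

    square : ∀ {w x y z} → w ~ x → x ~ y → y ~ z → w ≢ y → x ≢ z → z ~ w → Cycle G 4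
    square {w} {x} {y} {z} wx xy yz w≢y x≢z zw = record
      { vertex      = w ∷ᶠ x ∷ᶠ y ∷ᶠ z ∷ᶠ []ᶠ
      ; 3≤ℓ         = ℕ.n≤1+n 3
      ; injective   = λ
        { {0F} {0F} _  → refl
        ; {0F} {1F} eq → contradiction eq (~⇒≢ wx)
        ; {0F} {2F} eq → contradiction eq w≢y
        ; {0F} {3F} eq → contradiction (sym eq) (~⇒≢ zw)
        ; {1F} {0F} eq → contradiction (sym eq) (~⇒≢ wx)
        ; {1F} {1F} _  → refl
        ; {1F} {2F} eq → contradiction eq (~⇒≢ xy)
        ; {1F} {3F} eq → contradiction eq x≢z
        ; {2F} {0F} eq → contradiction (sym eq) w≢y
        ; {2F} {1F} eq → contradiction (sym eq) (~⇒≢ xy)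
        ; {2F} {2F} _  → refl
        ; {2F} {3F} eq → contradiction eq (~⇒≢ yz)
        ; {3F} {0F} eq → contradiction eq (~⇒≢ zw)
        ; {3F} {1F} eq → contradiction (sym eq) x≢z
        ; {3F} {2F} eq → contradiction (sym eq) (~⇒≢ yz)
        ; {3F} {3F} _  → refl
        }
      ; consecutive = λ
        { 0F 1F _ → wx ; 1F 2F _ → xy ; 2F 3F _ → yz
        ; 0F 0F () ; 0F 2F () ; 0F 3F () ; 1F 0F () ; 1F 1F () ; 1F 3F ()
        ; 2F 0F () ; 2F 1F () ; 2F 2F () ; 3F 0F () ; 3F 1F () ; 3F 2F () ; 3F 3F () }
      ; closing     = λ { 3F 0F _ _ → zw ; 0F _ () _ ; 1F _ () _ ; 2F _ () _ ; 3F 1F _ () ; 3F 2F _ () ; 3F 3F _ () }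
      }

    cycle-≥ : ∀ {g k ℓ} → IsGirth G g → [ k ] ≤⁺ g → Cycle G ℓ → k ℕ.≤ ℓ
    cycle-≥ (_ , minimal) [ k≤g ]   c = ℕ.≤-trans k≤g (minimal c)
    -- Infinite girth: there is no cycle to bound.
    cycle-≥ acyclic       (_ ≤⊤⁺) c = contradiction c acyclic

    girth≥5 : ∀ {g} → IsGirth G g → [ 5 ] ≤⁺ g → Girth≥5 G
    girth≥5 isGirth 5≤g = record
      { triangle-free = λ xy yz zx → ℕ.<⇒≱ (ℕ.n≤1+n 4) (cycle-≥ isGirth 5≤g (triangle xy yz zx))
      ; square-free   = λ wx xy yz w≢y x≢z zw → ℕ.n≮n 4 (cycle-≥ isGirth 5≤g (square wx xy yz w≢y x≢z zw))
      }

-- Transfer of the integer identity to the rationals.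

open IntegerCounts
open import Data.Integer as ℤ using (ℤ; +_)
import Data.Integer.Properties as ℤ
open import Data.Rational using (ℚ; 0ℚ; _+_; _-_; _*_; -_; _/_; fromℚᵘ; toℚᵘ)
open import Data.Rational.Base using (+-*-rawSemiring)
open import Data.Rational.Properties as ℚ using (fromℚᵘ-cong; fromℚᵘ-toℚᵘ; toℚᵘ-fromℚᵘ; toℚᵘ-homo-+; toℚᵘ-homo-*; toℚᵘ-homo‿-)
open import Data.Rational.Unnormalised as ℚᵘ using (ℚᵘ; mkℚᵘ; *≡*)
import Data.Rational.Unnormalised.Properties as ℚᵘ
open import Algebra.Definitions.RawSemiring +-*-rawSemiring using (_^_)
open import Relation.Nullary.Decidable using (dec⇒maybe)
open import Tactic.RingSolver using (solve-∀)
open import Tactic.RingSolver.Core.AlmostCommutativeRing using (AlmostCommutativeRing; fromCommutativeRing)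

ℚ-ring : AlmostCommutativeRing 0ℓ 0ℓ
ℚ-ring = fromCommutativeRing ℚ.+-*-commutativeRing λ x → dec⇒maybe (0ℚ ℚ.≟ x)

ιᵘ : ℤ → ℚᵘ
ιᵘ i = mkℚᵘ i 0

opaque
  -- While it is opaque, an image stays a formal expression from which its integer can be read off,
  -- instead of unfolding into a normalised fraction.
  ι : ℤ → ℚ
  ι i = i / 1

  toℚᵘ-ι : ∀ i → ιᵘ i ℚᵘ.≃ toℚᵘ (ι i)
  toℚᵘ-ι i = ℚᵘ.≃-sym (toℚᵘ-fromℚᵘ (ιᵘ i))

  -- Checked in the unnormalised rationals, where denominators 1 make the identity visible without
  -- any gcd; `fromℚᵘ` respects equivalence and carries it over.
  ι-homo-+ : ∀ i j → ι (i ℤ.+ j) ≡ ι i + ι j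
  ι-homo-+ i j = begin
    ι (i ℤ.+ j)                       ≡⟨ fromℚᵘ-cong {ιᵘ (i ℤ.+ j)} {ιᵘ i ℚᵘ.+ ιᵘ j}
                                             (*≡* (cong₂ (λ x y → (x ℤ.+ y) ℤ.* + 1) (sym (ℤ.*-identityʳ i)) (sym (ℤ.*-identityʳ j)))) ⟩
    fromℚᵘ (ιᵘ i ℚᵘ.+ ιᵘ j)           ≡⟨ fromℚᵘ-cong (ℚᵘ.+-cong (toℚᵘ-ι i) (toℚᵘ-ι j)) ⟩
    fromℚᵘ (toℚᵘ (ι i) ℚᵘ.+ toℚᵘ (ι j)) ≡⟨ fromℚᵘ-cong (toℚᵘ-homo-+ (ι i) (ι j)) ⟨
    fromℚᵘ (toℚᵘ (ι i + ι j))         ≡⟨ fromℚᵘ-toℚᵘ (ι i + ι j) ⟩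
    ι i + ι j                         ∎
    where open ≡-Reasoning

  ι-homo-* : ∀ i j → ι (i ℤ.* j) ≡ ι i * ι j
  ι-homo-* i j = begin
    fromℚᵘ (ιᵘ i ℚᵘ.* ιᵘ j)           ≡⟨ fromℚᵘ-cong (ℚᵘ.*-cong (toℚᵘ-ι i) (toℚᵘ-ι j)) ⟩
    fromℚᵘ (toℚᵘ (ι i) ℚᵘ.* toℚᵘ (ι j)) ≡⟨ fromℚᵘ-cong (toℚᵘ-homo-* (ι i) (ι j)) ⟨
    fromℚᵘ (toℚᵘ (ι i * ι j))         ≡⟨ fromℚᵘ-toℚᵘ (ι i * ι j) ⟩
    ι i * ι j                         ∎
    where open ≡-Reasoning

  ι-homo-neg : ∀ i → ι (ℤ.- i) ≡ - ι i
  ι-homo-neg i = begin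
    fromℚᵘ (ℚᵘ.- ιᵘ i)                ≡⟨ fromℚᵘ-cong (ℚᵘ.-‿cong (toℚᵘ-ι i)) ⟩
    fromℚᵘ (ℚᵘ.- toℚᵘ (ι i))          ≡⟨ fromℚᵘ-cong (toℚᵘ-homo‿- (ι i)) ⟨
    fromℚᵘ (toℚᵘ (- ι i))             ≡⟨ fromℚᵘ-toℚᵘ (- ι i) ⟩
    - ι i                             ∎
    where open ≡-Reasoning

  ι-+ : ∀ k → ι (+ k) ≡ ↑ k
  ι-+ k = refl

infixl 6 _⟨+⟩_ _⟨-⟩_
infixl 7 _⟨*⟩_
infixr 8 _⟨^⟩_

-- With its companions it translates an integer polynomial by repeating its shape, so no separate
-- rewriting of subterms is needed.
_⟨+⟩_ : ∀ {i j q r} → ι i ≡ q → ι j ≡ r → ι (i ℤ.+ j) ≡ q + r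
_⟨+⟩_ {i} {j} refl refl = ι-homo-+ i j

_⟨-⟩_ : ∀ {i j q r} → ι i ≡ q → ι j ≡ r → ι (i ℤ.- j) ≡ q - r
_⟨-⟩_ {i} {j} refl refl = trans (ι-homo-+ i (ℤ.- j)) (cong (λ r → ι i + r) (ι-homo-neg j))

_⟨*⟩_ : ∀ {i j q r} → ι i ≡ q → ι j ≡ r → ι (i ℤ.* j) ≡ q * r
_⟨*⟩_ {i} {j} refl refl = ι-homo-* i j

_⟨^⟩_ : ∀ {i q} → ι i ≡ q → ∀ k → ι (i ^′ k) ≡ q ^ k
eq ⟨^⟩ zero  = ι-+ 1
_⟨^⟩_ {i} eq (suc k) = trans (cong ι (^-suc i k)) (eq ⟨*⟩ (eq ⟨^⟩ k))

ι-♯ : ∀ k → ι (♯ k) ≡ ↑ k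
ι-♯ k = trans (cong ι (♯≡+ k)) (ι-+ k)

-- The polynomials A, B, C, D, X, Y in the number of edges are left uninterpreted.
rearrange : ∀ m M² M α α₂ β M₂ F M₄ M₂₂ EM M₅ s₁ s₂ s₃ s₄ s₅ A B C D X Y →
  (+ 1 / 120) *
    ( m * A + ↑ 30 * M² - ↑ 12 * (α * X) - ↑ 20 * α₂ - ↑ 2 * (M * B) + ↑ 12 * β
    + ↑ 2 * (M₂ * C) + F * D + ↑ 2 * (M₄ * Y) + ↑ 6 * M₂₂ - ↑ 24 * EM - ↑ 5 * M₅
    + ↑ 3 * s₁ + ↑ 8 * s₂ - ↑ 6 * s₃ - ↑ 24 * s₄ + ↑ 24 * s₅ ) ≡
  (+ 1 / 5) *
    ( (+ 1 / 24) * m * A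
    + (+ 5 / 4) * M²
    - (+ 1 / 2) * α * X
    - (+ 5 / 6) * α₂
    - (+ 1 / 12) * M * B
    + (+ 1 / 2) * β
    + (+ 1 / 12) * M₂ * C
    + (+ 1 / 24) * F * D
    + (+ 1 / 12) * M₄ * Y
    + (+ 1 / 4) * M₂₂
    - EM
    - (+ 5 / 24) * M₅
    + (+ 1 / 8) * s₁
    + (+ 1 / 3) * s₂
    - (+ 1 / 4) * s₃
    - s₄
    + s₅
    )
rearrange = solve-∀ ℚ-ring

theorem2p10 : ∀ {n : ℕ} (G : Graph n) {g : ℕ ⁺} → IsGirth G g → [ 5 ] ≤⁺ g →
    let m = ↑ size G in
    ↑ p G 5 ≡ (+ 1 / 5) *
    ( (+ 1 / 24) * m * (m ^ 4 + ↑ 10 * m ^ 3 + ↑ 43 * m ^ 2 + ↑ 54 * m - ↑ 328)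
    + (+ 5 / 4) * (↑ M₁ G) ^ 2
    - (+ 1 / 2) * ↑ α G 1 * (m - ↑ 7)
    - (+ 5 / 6) * ↑ α G 2
    - (+ 1 / 12) * ↑ M₁ G * (↑ 2 * m ^ 3 + ↑ 30 * m ^ 2 + ↑ 61 * m - ↑ 225)
    + (+ 1 / 2) * ↑ β G
    + (+ 1 / 12) * ↑ M₂ G * (↑ 6 * m ^ 2 + ↑ 66 * m - ↑ 239)
    + (+ 1 / 24) * ↑ F G * (↑ 6 * m ^ 2 + ↑ 24 * m - ↑ 149)
    + (+ 1 / 12) * ↑ M₁^ G 4 * (m + ↑ 10)
    + (+ 1 / 4) * ↑ M₂^ G 2
    - ↑ EM₂ G
    - (+ 5 / 24) * ↑ M₁^ G 5
    + (+ 1 / 8) * ↑ (∑ (edges G) λ (u , v) → M₁ (G -[ u , v ]) ℕ.^ 2)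
    + (+ 1 / 3) * ↑ (∑ (edges G) λ (u , v) → size (G -[ u , v ]) ℕ.* F (G -[ u , v ]))
    - (+ 1 / 4) * ↑ (∑ (edges G) λ (u , v) → size (G -[ u , v ]) ℕ.^ 2 ℕ.* M₁ (G -[ u , v ]))
    - ↑ (∑ (edges G) λ (u , v) → EM₂ (G -[ u , v ]))
    + ↑ (∑ (edges G) λ (u , v) → size (G -[ u , v ]) ℕ.* M₂ (G -[ u , v ]))
    )
theorem2p10 {n} G isGirth 5≤g = begin
  ↑ p G 5
    ≡⟨ unscale (↑ p G 5) ⟩
  (+ 1 / 120) * (↑ 120 * ↑ p G 5)
    ≡⟨ cong ((+ 1 / 120) *_) (trans (sym (ι-+ 120 ⟨*⟩ ι-♯ (p G 5)))
         (trans (cong ι (p₅ G (girth≥5 G isGirth 5≤g) sum₁ sum₂ sum₃ (sym (♯-∑ (edges G) f₄)) sum₅)) image)) ⟩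
  _ ≡⟨ rearrange m (M ^ 2) M (↑ α G 1) (↑ α G 2) (↑ β G) (↑ M₂ G) (↑ F G) (↑ M₁^ G 4) (↑ M₂^ G 2) (↑ EM₂ G) (↑ M₁^ G 5)
         (↑ ∑ (edges G) f₁) (↑ ∑ (edges G) f₂) (↑ ∑ (edges G) f₃) (↑ ∑ (edges G) f₄) (↑ ∑ (edges G) f₅)
         (m ^ 4 + ↑ 10 * m ^ 3 + ↑ 43 * m ^ 2 + ↑ 54 * m - ↑ 328) (↑ 2 * m ^ 3 + ↑ 30 * m ^ 2 + ↑ 61 * m - ↑ 225)
         (↑ 6 * m ^ 2 + ↑ 66 * m - ↑ 239) (↑ 6 * m ^ 2 + ↑ 24 * m - ↑ 149) (m - ↑ 7) (m + ↑ 10) ⟩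
  _ ∎
  where
  open ≡-Reasoning
  m M : ℚ
  m = ↑ size G
  M = ↑ M₁ G
  unscale : ∀ x → x ≡ (+ 1 / 120) * (↑ 120 * x)
  unscale = solve-∀ ℚ-ring
  f₁ f₂ f₃ f₄ f₅ : Edge n → ℕ
  f₁ (u , v) = M₁ (G -[ u , v ]) ℕ.^ 2
  f₂ (u , v) = size (G -[ u , v ]) ℕ.* F (G -[ u , v ])
  f₃ (u , v) = size (G -[ u , v ]) ℕ.^ 2 ℕ.* M₁ (G -[ u , v ])
  f₄ (u , v) = EM₂ (G -[ u , v ])
  f₅ (u , v) = size (G -[ u , v ]) ℕ.* M₂ (G -[ u , v ])
  sum₁ : Σ (edges G) (λ (u , v) → (♯ M₁ (G -[ u , v ])) ^′ 2) ≡ ♯ ∑ (edges G) f₁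
  sum₁ = sym (trans (♯-∑ (edges G) f₁) (Σ-cong (edges G) λ (u , v) → ♯-homo-^ (M₁ (G -[ u , v ])) 2))
  sum₂ : Σ (edges G) (λ (u , v) → ♯ size (G -[ u , v ]) ℤ.* ♯ F (G -[ u , v ])) ≡ ♯ ∑ (edges G) f₂
  sum₂ = sym (trans (♯-∑ (edges G) f₂) (Σ-cong (edges G) λ (u , v) → ♯-homo-* (size (G -[ u , v ])) (F (G -[ u , v ]))))
  sum₃ : Σ (edges G) (λ (u , v) → (♯ size (G -[ u , v ])) ^′ 2 ℤ.* ♯ M₁ (G -[ u , v ])) ≡ ♯ ∑ (edges G) f₃
  sum₃ = sym (trans (♯-∑ (edges G) f₃) (Σ-cong (edges G) λ (u , v) →
    trans (♯-homo-* (size (G -[ u , v ]) ℕ.^ 2) (M₁ (G -[ u , v ])))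
          (cong (ℤ._* ♯ M₁ (G -[ u , v ])) (♯-homo-^ (size (G -[ u , v ])) 2))))
  sum₅ : Σ (edges G) (λ (u , v) → ♯ size (G -[ u , v ]) ℤ.* ♯ M₂ (G -[ u , v ])) ≡ ♯ ∑ (edges G) f₅
  sum₅ = sym (trans (♯-∑ (edges G) f₅) (Σ-cong (edges G) λ (u , v) → ♯-homo-* (size (G -[ u , v ])) (M₂ (G -[ u , v ]))))
  𝑚 = ι-♯ (size G)
  c = ι-+
  -- Repeats the right-hand side of `p₅` operation by operation; the rational polynomial it is equal
  -- to is inferred from this shape.
  image = 𝑚 ⟨*⟩ (𝑚 ⟨^⟩ 4 ⟨+⟩ c 10 ⟨*⟩ 𝑚 ⟨^⟩ 3 ⟨+⟩ c 43 ⟨*⟩ 𝑚 ⟨^⟩ 2 ⟨+⟩ c 54 ⟨*⟩ 𝑚 ⟨-⟩ c 328) ⟨+⟩ c 30 ⟨*⟩ ι-♯ (M₁ G) ⟨^⟩ 2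
    ⟨-⟩ c 12 ⟨*⟩ (ι-♯ (α G 1) ⟨*⟩ (𝑚 ⟨-⟩ c 7)) ⟨-⟩ c 20 ⟨*⟩ ι-♯ (α G 2)
    ⟨-⟩ c 2 ⟨*⟩ (ι-♯ (M₁ G) ⟨*⟩ (c 2 ⟨*⟩ 𝑚 ⟨^⟩ 3 ⟨+⟩ c 30 ⟨*⟩ 𝑚 ⟨^⟩ 2 ⟨+⟩ c 61 ⟨*⟩ 𝑚 ⟨-⟩ c 225)) ⟨+⟩ c 12 ⟨*⟩ ι-♯ (β G)
    ⟨+⟩ c 2 ⟨*⟩ (ι-♯ (M₂ G) ⟨*⟩ (c 6 ⟨*⟩ 𝑚 ⟨^⟩ 2 ⟨+⟩ c 66 ⟨*⟩ 𝑚 ⟨-⟩ c 239))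
    ⟨+⟩ ι-♯ (F G) ⟨*⟩ (c 6 ⟨*⟩ 𝑚 ⟨^⟩ 2 ⟨+⟩ c 24 ⟨*⟩ 𝑚 ⟨-⟩ c 149)
    ⟨+⟩ c 2 ⟨*⟩ (ι-♯ (M₁^ G 4) ⟨*⟩ (𝑚 ⟨+⟩ c 10)) ⟨+⟩ c 6 ⟨*⟩ ι-♯ (M₂^ G 2) ⟨-⟩ c 24 ⟨*⟩ ι-♯ (EM₂ G) ⟨-⟩ c 5 ⟨*⟩ ι-♯ (M₁^ G 5)
    ⟨+⟩ c 3 ⟨*⟩ ι-♯ (∑ (edges G) f₁) ⟨+⟩ c 8 ⟨*⟩ ι-♯ (∑ (edges G) f₂) ⟨-⟩ c 6 ⟨*⟩ ι-♯ (∑ (edges G) f₃)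
    ⟨-⟩ c 24 ⟨*⟩ ι-♯ (∑ (edges G) f₄) ⟨+⟩ c 24 ⟨*⟩ ι-♯ (∑ (edges G) f₅)
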